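{- Let $S(x,y;t,v)=\sum_{w}x^{i(w)}y^{j(w)}t^{|w|}v^{\mathrm{vert}(w)}$, where the sum runs over all walks $w$ on the slit plane on the ordinary square lattice, $(i(w),j(w))$ is the endpoint, $|w|$ the length and $\mathrm{vert}(w)$ the number of vertical steps $(0,\pm1)$. Let $\delta_1=(1-2t(1+v))(1+2t(1-v))$ and $\delta_2=(1-2t(1-v))(1+2t(1+v))$. Then $$S(x,y;t,v)=\frac{\left(1-2t(v+\bar x)+\sqrt{\delta_1}\right)^{1/2}\left(1+2t(v-\bar x)+\sqrt{\delta_2}\right)^{1/2}}{2\left(1-t(x+\bar x+yv+\bar yv)\right)},$$ with radicals the power series in $t$ with positive constant term.
   Context: $\mathcal H=\{(k,0):k\le0\}$. A walk on the slit plane (ordinary square lattice) is a sequence $(w_0,\dots,w_n)$ in $\mathbb{Z}^2$ with $w_0=(0,0)$, $w_m-w_{m-1}\in\{(\pm1,0),(0,\pm1)\}$, and $w_m\notin\mathcal H$ for $1\le m\le n$. $\bar x=1/x$, $\bar y=1/y$. -}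

module Defs where

open import Algebra.Bundles.Raw using (RawRing)
import Algebra.Definitions.RawMonoid as RawMonoidDefs
open import Data.Bool.Base using (if_then_else_)
open import Data.Fin.Base using (toℕ)
import Data.Integer as ℤ
open ℤ using (ℤ; 0ℤ; 1ℤ; -1ℤ)
open import Data.List.Base as List using (List; []; _∷_; _++_)
import Data.Nat as ℕ
open ℕ using (ℕ; zero; suc; _∸_)
open import Data.Product using (_×_; _,_; ∃-syntax)
open import Data.Product.Properties using (≡-dec)
import Data.Rational as ℚ
open ℚ using (ℚ; 0ℚ; 1ℚ)
open import Data.Sum using (_⊎_)
open import Data.Vec.Base as Vec using (Vec; []; _∷_)
open import Data.Vec.Relation.Unary.All using (All; all?)
open import Level using (0ℓ)
open import Relation.Binary.Definitions using (DecidableEquality)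
open import Relation.Binary.PropositionalEquality using (_≡_)
open import Relation.Nullary using (¬_; yes; no; does)
open import Relation.Nullary.Decidable using (¬?; _×-dec_)
open import Relation.Unary using (Decidable)

------------------------------------------------------------------------
-- Walks on the slit plane

Point : Set
Point = ℤ × ℤ

origin : Point
origin = 0ℤ , 0ℤ

data Step : Set where
  east west north south : Step

move : Step → Point → Point
move east  (i , j) = i ℤ.+ 1ℤ , j
move west  (i , j) = i ℤ.- 1ℤ , j
move north (i , j) = i , j ℤ.+ 1ℤ
move south (i , j) = i , j ℤ.- 1ℤ

data Vertical : Step → Set where
  north : Vertical north
  south : Vertical south

vertical? : Decidable Vertical
vertical? east  = no λ ()
vertical? west  = no λ ()
vertical? north = yes north
vertical? south = yes south

ℋ : Point → Set
ℋ (k , j) = k ℤ.≤ 0ℤ × j ≡ 0ℤ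

ℋ? : Decidable ℋ
ℋ? (k , j) = (k ℤ.≤? 0ℤ) ×-dec (j ℤ.≟ 0ℤ)

-- A walk (w₀,…,wₙ) from w₀ is encoded by its n steps;
-- vertices w₀ s is (w₁,…,wₙ), without the starting point.
vertices : ∀ {n} → Point → Vec Step n → Vec Point n
vertices p []      = []
vertices p (s ∷ w) = move s p ∷ vertices (move s p) w

endpoint : ∀ {n} → Vec Step n → Point
endpoint w = Vec.last (origin ∷ vertices origin w)

vert : ∀ {n} → Vec Step n → ℕ
vert = Vec.count vertical?

OnSlitPlane : ∀ {n} → Vec Step n → Set
OnSlitPlane w = All (λ p → ¬ ℋ p) (vertices origin w)

onSlitPlane? : ∀ {n} → Decidable (OnSlitPlane {n})
onSlitPlane? w = all? (λ p → ¬? (ℋ? p)) (vertices origin w)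

stepSequences : ∀ n → List (Vec Step n)
stepSequences zero    = [] ∷ []
stepSequences (suc n) =
  List.cartesianProductWith _∷_ (east ∷ west ∷ north ∷ south ∷ []) (stepSequences n)

slitWalks : ∀ n → List (Vec Step n)
slitWalks n = List.filter onSlitPlane? (stepSequences n)

------------------------------------------------------------------------
-- The field ℚ(√2). Two of the radicals have constant term √2, so ℚ is
-- too small; all coefficients of all the radicals lie in ℚ(√2).

infix 5 _+_√2

record ℚ√2 : Set where
  constructor _+_√2
  field
    rat  : ℚ
    surd : ℚ

infixl 7 _*ᴷ_
infixl 6 _+ᴷ_

_+ᴷ_ _*ᴷ_ : ℚ√2 → ℚ√2 → ℚ√2
(a + b √2) +ᴷ (c + d √2) = (a ℚ.+ c) + (b ℚ.+ d) √2
(a + b √2) *ᴷ (c + d √2) =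
  (a ℚ.* c ℚ.+ (b ℚ.* d ℚ.+ b ℚ.* d)) + (a ℚ.* d ℚ.+ b ℚ.* c) √2

-ᴷ_ : ℚ√2 → ℚ√2
-ᴷ (a + b √2) = (ℚ.- a) + (ℚ.- b) √2

ℚ√2-rawRing : RawRing 0ℓ 0ℓ
ℚ√2-rawRing = record
  { Carrier = ℚ√2
  ; _≈_     = _≡_
  ; _+_     = _+ᴷ_
  ; _*_     = _*ᴷ_
  ; -_      = -ᴷ_
  ; 0#      = 0ℚ + 0ℚ √2
  ; 1#      = 1ℚ + 0ℚ √2
  }

-- a + b√2 > 0 as a real number: either a > |b√2|, or b√2 > |a|.
-- (The case a² = 2b² only occurs for a = b = 0.)
Positive : ℚ√2 → Set
Positive (a + b √2) =
    (0ℚ ℚ.< a × b ℚ.* b ℚ.+ b ℚ.* b ℚ.< a ℚ.* a)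
  ⊎ (0ℚ ℚ.< b × a ℚ.* a ℚ.< b ℚ.* b ℚ.+ b ℚ.* b)

------------------------------------------------------------------------
-- The ring ℚ(√2)[x, x̄, y, ȳ, v]

-- (i , j , k) stands for xⁱ yʲ vᵏ.
Monomial : Set
Monomial = ℤ × ℤ × ℕ

_≟ᴹ_ : DecidableEquality Monomial
_≟ᴹ_ = ≡-dec ℤ._≟_ (≡-dec ℤ._≟_ ℕ._≟_)

_·ᴹ_ : Monomial → Monomial → Monomial
(i , j , k) ·ᴹ (i′ , j′ , k′) = i ℤ.+ i′ , j ℤ.+ j′ , k ℕ.+ k′

-- A formal sum of terms; a monomial may occur several times, so
-- polynomials are compared through their coefficients.
Poly : Set
Poly = List (ℚ√2 × Monomial)

module _ where
  open RawRing ℚ√2-rawRing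

  coeff : Poly → Monomial → ℚ√2
  coeff []            m = 0#
  coeff ((c , n) ∷ p) m = (if does (n ≟ᴹ m) then c else 0#) + coeff p m

  scalar : ℚ√2 → Poly
  scalar c = (c , (0ℤ , 0ℤ , 0)) ∷ []

  monomial : Monomial → Poly
  monomial m = (1# , m) ∷ []

  mulTerm : ℚ√2 × Monomial → ℚ√2 × Monomial → ℚ√2 × Monomial
  mulTerm (c , m) (d , n) = c * d , m ·ᴹ n

  negTerm : ℚ√2 × Monomial → ℚ√2 × Monomial
  negTerm (c , m) = - c , m

  Poly-rawRing : RawRing 0ℓ 0ℓ
  Poly-rawRing = record
    { Carrier = Poly
    ; _≈_     = λ p q → ∀ m → coeff p m ≡ coeff q m
    ; _+_     = _++_
    ; _*_     = List.cartesianProductWith mulTerm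
    ; -_      = List.map negTerm
    ; 0#      = []
    ; 1#      = scalar 1#
    }

------------------------------------------------------------------------
-- Formal power series in t over a ring

module _ {c ℓ} (R : RawRing c ℓ) where
  open RawRing R
  open RawMonoidDefs +-rawMonoid using (sum)

  constant : Carrier → ℕ → Carrier
  constant a zero    = a
  constant a (suc n) = 0#

  indeterminate : ℕ → Carrier
  indeterminate 1 = 1#
  indeterminate _ = 0#

  PowerSeries-rawRing : RawRing c ℓ
  PowerSeries-rawRing = record
    { Carrier = ℕ → Carrier
    ; _≈_     = λ f g → ∀ n → f n ≈ g n
    ; _+_     = λ f g n → f n + g n
    ; _*_     = λ f g n → sum {suc n} λ k → f (toℕ k) * g (n ∸ toℕ k)
    ; -_      = λ f n → - f n
    ; 0#      = constant 0#
    ; 1#      = constant 1#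
    }

------------------------------------------------------------------------
-- The ring ℚ(√2)[x, x̄, y, ȳ, v][[t]]

open RawRing (PowerSeries-rawRing Poly-rawRing) public
  using (_≈_; _+_; _*_; -_; 1#)
  renaming (Carrier to Series)

infixl 6 _-_

_-_ : Series → Series → Series
f - g = f + (- g)

2# : Series
2# = 1# + 1#

t x x̄ y ȳ v : Series
t = indeterminate Poly-rawRing
x = constant Poly-rawRing (monomial (1ℤ  , 0ℤ  , 0))
x̄ = constant Poly-rawRing (monomial (-1ℤ , 0ℤ  , 0))
y = constant Poly-rawRing (monomial (0ℤ  , 1ℤ  , 0))
ȳ = constant Poly-rawRing (monomial (0ℤ  , -1ℤ , 0))
v = constant Poly-rawRing (monomial (0ℤ  , 0ℤ  , 1))

infix 4 _IsSqrtOf_ _IsReciprocalOf_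

-- r is the square root of f with positive constant term. Such an r is
-- unique: its constant term is the positive root of that of f, and the
-- coefficient of each higher power of t is determined by the lower ones.
_IsSqrtOf_ : Series → Series → Set
r IsSqrtOf f =
  (r * r ≈ f) × (∃[ c ] (Positive c × RawRing._≈_ Poly-rawRing (r 0) (scalar c)))

_IsReciprocalOf_ : Series → Series → Set
g IsReciprocalOf f = f * g ≈ 1#

δ₁ δ₂ : Series
δ₁ = (1# - 2# * t * (1# + v)) * (1# + 2# * t * (1# - v))
δ₂ = (1# - 2# * t * (1# - v)) * (1# + 2# * t * (1# + v))

weight : ∀ {n} → Vec Step n → Poly
weight w with i , j ← endpoint w = monomial (i , j , vert w)

S : Series
S n = List.concatMap weight (slitWalks n)

{-# OPTIONS --safe #-}
module Submission where

-- Let K = 1 - t(x + x̄ + yv + ȳv). Removing the last step of a walk shows that S is the only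
-- series such that K S is supported on ℋ while S itself coincides with 1 on ℋ, so it suffices
-- to find a series H supported on ℋ such that G = H/K coincides with 1 on ℋ.
--
-- The coefficient of y⁰ in 1/K is 1/√Δ, where Δ = (1 - t(x + x̄))² - 4t²v² is the product of
-- 1 - t(x + x̄) ∓ 2tv, and each of these factors splits as e (1 - θx)(1 - θx̄) with e and θ free
-- of x. Taking for H the product of the two √e √(1 - θx̄), the coefficient of y⁰ in G is
-- 1/(√(1 - θ₁x) √(1 - θ₂x)), which is 1 plus positive powers of x. Finally 2e (1 - θx̄) is
-- the radicand 1 ∓ 2tv - 2tx̄ + √δ of the statement.

open import Algebra using (RawRing; CommutativeRing; IsCommutativeRing)
import Algebra.Consequences.Setoid as Consequences
import Algebra.Definitions as AlgebraDefinitions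
import Algebra.Properties.AbelianGroup as AbelianGroupProperties
import Algebra.Properties.Ring as RingProperties
import Algebra.Properties.Semiring.Mult.TCOptimised as Mult
import Algebra.Solver.Ring as RingSolver
open import Algebra.Solver.Ring.AlmostCommutativeRing using (fromCommutativeRing; _-Raw-AlmostCommutative⟶_)
open import Data.Bool.Base using (if_then_else_)
import Data.Integer as ℤ
import Data.Integer.Properties as ℤₚ
open ℤ using (ℤ; +_; -[1+_]; _⊖_; 0ℤ; 1ℤ; -1ℤ)
open import Data.List.Base as List using (List; []; _∷_; _++_)
import Data.List.Properties as Listₚ
open import Data.List.Relation.Unary.All as All using (All; []; _∷_)
import Data.List.Relation.Unary.All.Properties as Allₚ
open import Data.Maybe.Base using (Maybe; map)
import Data.Nat as ℕ
import Data.Nat.Properties as ℕₚ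
open ℕ using (ℕ; zero; suc; z≤n; s≤s)
open import Data.Product using (_×_; _,_; ∃-syntax; proj₁; proj₂; map₂)
import Data.Rational as ℚ
import Data.Rational.Properties as ℚₚ
open import Data.Sum using (_⊎_; inj₁; inj₂; [_,_]′)
open import Data.Vec.Base as Vec using (Vec; []; _∷_)
import Data.Vec.Relation.Unary.All as VecAll
open import Function using (_∘_; _⇔_; mk⇔; Equivalence)
open import Level using (0ℓ; _⊔_)
open import Relation.Binary.Bundles using (Setoid)
open import Relation.Binary.Consequences using (dec⇒weaklyDec)
import Relation.Binary.PropositionalEquality as ≡
open ≡ using (_≡_; _≢_; cong; cong₂)
import Relation.Binary.Reasoning.Setoid as SetoidReasoning
open import Relation.Binary.Structures using (IsEquivalence)
open import Relation.Nullary using (¬_; ¬?; Dec; yes; no; does; contradiction)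
open import Relation.Nullary.Decidable using (toSum)
open import Relation.Unary using (Pred; Decidable)

open import Defs using
  ( PowerSeries-rawRing; constant; indeterminate
  ; ℚ√2; _+_√2; ℚ√2-rawRing
  ; Monomial; _≟ᴹ_; _·ᴹ_; Poly; coeff; mulTerm; negTerm; Poly-rawRing; monomial; scalar
  ; Point; origin; Step; east; west; north; south; move; ℋ; ℋ?; vertices; vert; stepSequences
  )

-- Inverses, square roots, `θ` and `Y` are all solutions of one kind of equation,
-- `w = α + t (β w + γ w²)`. The factor `t` makes the right side contractive, so each coefficient of
-- the solution is reached after finitely many ring operations, and every condition on exponents
-- that ring operations preserve passes to it. This controls the supports of series that are known
-- only implicitly: it is enough to inspect the generators.
--
-- The shape of `H` is forced: the coefficient of y⁰ in `H/K` is `H/√Δ`, so a quotient free of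
-- negative powers of `x` must leave in `H` exactly the factors of `√Δ` that contain `x̄`. The other
-- powers of `y` are separated by factoring `K` as a quadratic in `y`, which yields a second
-- expression for `√Δ`; uniqueness of square roots identifies the two.
--
-- Square roots are first built with constant term 1. The radicands of the statement are
-- `2e (1 - θx̄)`, so each of their roots carries an extra √2, and the two factors √2 cancel the 2
-- of the denominator.

record CommutativeRingLaws {c ℓ} (R : RawRing c ℓ) : Set (c ⊔ ℓ) where
  open RawRing R
  open AlgebraDefinitions _≈_
  field
    isEquivalence : IsEquivalence _≈_
    +-cong        : Congruent₂ _+_
    +-assoc       : Associative _+_
    +-comm        : Commutative _+_
    +-identityˡ   : LeftIdentity 0# _+_
    -‿cong        : Congruent₁ (-_)
    -‿inverseˡ    : LeftInverse 0# (-_) _+_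
    *-cong        : Congruent₂ _*_
    *-assoc       : Associative _*_
    *-comm        : Commutative _*_
    *-identityˡ   : LeftIdentity 1# _*_
    distribʳ      : _*_ DistributesOverʳ _+_

  private
    setoid : Setoid c ℓ
    setoid = record { isEquivalence = isEquivalence }
    open Consequences setoid

  isCommutativeRing : IsCommutativeRing _≈_ _+_ _*_ (-_) 0# 1#
  isCommutativeRing = record
    { isRing = record
      { +-isAbelianGroup = record
        { isGroup = record
          { isMonoid = record
            { isSemigroup = record
              { isMagma = record { isEquivalence = isEquivalence ; ∙-cong = +-cong }
              ; assoc   = +-assoc
              }
            ; identity = comm∧idˡ⇒id +-comm +-identityˡ
            }
          ; inverse = comm∧invˡ⇒inv +-comm -‿inverseˡ
          ; ⁻¹-cong = -‿cong
          }
        ; comm = +-comm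
        }
      ; *-cong     = *-cong
      ; *-assoc    = *-assoc
      ; *-identity = comm∧idˡ⇒id *-comm *-identityˡ
      ; distrib    = comm∧distrʳ⇒distr +-cong *-comm distribʳ
      }
    ; *-comm = *-comm
    }

  commutativeRing : CommutativeRing c ℓ
  commutativeRing = record { isCommutativeRing = isCommutativeRing }

-- Solver for ring identities with integer coefficients

module IntegerCoefficientSolver {c ℓ} (R : CommutativeRing c ℓ) where
  open CommutativeRing R
  open RingProperties ring
  open AbelianGroupProperties +-abelianGroup using (⁻¹-∙-comm)
  open Mult semiring using (×-homo-+; ×1-homo-*; 1+×) renaming (_×_ to _∙_)
  open SetoidReasoning setoid

  -- With the type-checking-optimised multiples, con (+ 1) and con (+ 2) denote 1# and
  -- 1# + 1# definitionally.
  ⟦_⟧ℤ : ℤ → Carrier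
  ⟦ + n ⟧ℤ      = n ∙ 1#
  ⟦ -[1+ n ] ⟧ℤ = - (suc n ∙ 1#)

  private
    cancel-1 : ∀ a b → a - b ≈ (1# + a) - (1# + b)
    cancel-1 a b = begin
      a - b                     ≈⟨ +-congʳ (+-identityʳ a) ⟨
      (a + 0#) - b              ≈⟨ +-congʳ (+-congˡ (-‿inverseʳ 1#)) ⟨
      (a + (1# - 1#)) - b       ≈⟨ +-congʳ (+-assoc a 1# (- 1#)) ⟨
      ((a + 1#) - 1#) - b       ≈⟨ +-assoc (a + 1#) (- 1#) (- b) ⟩
      (a + 1#) + (- 1# - b)     ≈⟨ +-cong (+-comm a 1#) (⁻¹-∙-comm 1# b) ⟩
      (1# + a) - (1# + b)       ∎

    ⊖-homo : ∀ m n → ⟦ m ⊖ n ⟧ℤ ≈ m ∙ 1# - n ∙ 1#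
    ⊖-homo zero    zero    = sym (-‿inverseʳ 0#)
    ⊖-homo zero    (suc n) = sym (+-identityˡ _)
    ⊖-homo (suc m) zero    = begin
      suc m ∙ 1#           ≈⟨ +-identityʳ _ ⟨
      suc m ∙ 1# + 0#      ≈⟨ +-congˡ -0#≈0# ⟨
      suc m ∙ 1# - 0#      ∎
    ⊖-homo (suc m) (suc n) = begin
      ⟦ suc m ⊖ suc n ⟧ℤ              ≡⟨ ≡.cong ⟦_⟧ℤ (ℤₚ.[1+m]⊖[1+n]≡m⊖n m n) ⟩
      ⟦ m ⊖ n ⟧ℤ                      ≈⟨ ⊖-homo m n ⟩
      m ∙ 1# - n ∙ 1#                 ≈⟨ cancel-1 _ _ ⟩
      (1# + m ∙ 1#) - (1# + n ∙ 1#)   ≈⟨ +-cong (1+× m 1#) (-‿cong (1+× n 1#)) ⟨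
      suc m ∙ 1# - suc n ∙ 1#         ∎

    -homo : ∀ m → ⟦ ℤ.- m ⟧ℤ ≈ - ⟦ m ⟧ℤ
    -homo (+ zero)   = sym -0#≈0#
    -homo (+ suc n)  = refl
    -homo (-[1+ n ]) = sym (-‿involutive _)

    +homo : ∀ m n → ⟦ m ℤ.+ n ⟧ℤ ≈ ⟦ m ⟧ℤ + ⟦ n ⟧ℤ
    +homo (+ m)    (+ n)    = ×-homo-+ 1# m n
    +homo (+ m)    -[1+ n ] = ⊖-homo m (suc n)
    +homo -[1+ m ] (+ n)    = trans (⊖-homo n (suc m)) (+-comm _ _)
    +homo -[1+ m ] -[1+ n ] = begin
      - (suc (suc (m ℕ.+ n)) ∙ 1#)       ≡⟨ ≡.cong (λ k → - (k ∙ 1#)) (ℕₚ.+-suc (suc m) n) ⟨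
      - ((suc m ℕ.+ suc n) ∙ 1#)         ≈⟨ -‿cong (×-homo-+ 1# (suc m) (suc n)) ⟩
      - (suc m ∙ 1# + suc n ∙ 1#)        ≈⟨ ⁻¹-∙-comm _ _ ⟨
      - (suc m ∙ 1#) - suc n ∙ 1#        ∎

    +*+homo : ∀ m n → ⟦ + m ℤ.* + n ⟧ℤ ≈ ⟦ + m ⟧ℤ * ⟦ + n ⟧ℤ
    +*+homo m n = trans (reflexive (≡.cong ⟦_⟧ℤ (≡.sym (ℤₚ.pos-* m n)))) (×1-homo-* m n)

    *homo : ∀ m n → ⟦ m ℤ.* n ⟧ℤ ≈ ⟦ m ⟧ℤ * ⟦ n ⟧ℤ
    *homo (+ m)    (+ n)    = +*+homo m n
    *homo (+ m)    -[1+ n ] = begin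
      ⟦ + m ℤ.* -[1+ n ] ⟧ℤ           ≡⟨ ≡.cong ⟦_⟧ℤ (ℤₚ.neg-distribʳ-* (+ m) (+ suc n)) ⟨
      ⟦ ℤ.- (+ m ℤ.* + suc n) ⟧ℤ      ≈⟨ -homo (+ m ℤ.* + suc n) ⟩
      - ⟦ + m ℤ.* + suc n ⟧ℤ          ≈⟨ -‿cong (+*+homo m (suc n)) ⟩
      - (m ∙ 1# * suc n ∙ 1#)         ≈⟨ -‿distribʳ-* _ _ ⟩
      m ∙ 1# * - (suc n ∙ 1#)         ∎
    *homo -[1+ m ] (+ n)    = begin
      ⟦ -[1+ m ] ℤ.* + n ⟧ℤ           ≡⟨ ≡.cong ⟦_⟧ℤ (ℤₚ.neg-distribˡ-* (+ suc m) (+ n)) ⟨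
      ⟦ ℤ.- (+ suc m ℤ.* + n) ⟧ℤ      ≈⟨ -homo (+ suc m ℤ.* + n) ⟩
      - ⟦ + suc m ℤ.* + n ⟧ℤ          ≈⟨ -‿cong (+*+homo (suc m) n) ⟩
      - (suc m ∙ 1# * n ∙ 1#)         ≈⟨ -‿distribˡ-* _ _ ⟩
      - (suc m ∙ 1#) * n ∙ 1#         ∎
    *homo -[1+ m ] -[1+ n ] = begin
      (suc m ℕ.* suc n) ∙ 1#              ≈⟨ ×1-homo-* (suc m) (suc n) ⟩
      suc m ∙ 1# * suc n ∙ 1#             ≈⟨ -‿involutive _ ⟨
      - - (suc m ∙ 1# * suc n ∙ 1#)       ≈⟨ -‿cong (-‿distribʳ-* _ _) ⟩
      - (suc m ∙ 1# * - (suc n ∙ 1#))     ≈⟨ -‿distribˡ-* _ _ ⟩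
      - (suc m ∙ 1#) * - (suc n ∙ 1#)     ∎

    morphism : CommutativeRing.rawRing ℤₚ.+-*-commutativeRing -Raw-AlmostCommutative⟶ fromCommutativeRing R
    morphism = record
      { ⟦_⟧ = ⟦_⟧ℤ ; +-homo = +homo ; *-homo = *homo ; -‿homo = -homo ; 0-homo = refl ; 1-homo = refl }

    _≟_ : ∀ m n → Maybe (⟦ m ⟧ℤ ≈ ⟦ n ⟧ℤ)
    m ≟ n = map (λ eq → reflexive (≡.cong ⟦_⟧ℤ eq)) (dec⇒weaklyDec ℤ._≟_ m n)

  open RingSolver (CommutativeRing.rawRing ℤₚ.+-*-commutativeRing) (fromCommutativeRing R) morphism _≟_ public
    using (solve; con; _:+_; _:*_; :-_; _:-_; _:=_)

-- Power series

-- U need not respect _≈_: below it constrains the terms of a formal sum.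
record IsSubring {c ℓ p} (R : RawRing c ℓ) (U : Pred (RawRing.Carrier R) p) : Set (c ⊔ p) where
  open RawRing R
  field
    0∈ : U 0#
    1∈ : U 1#
    +∈ : ∀ {a b} → U a → U b → U (a + b)
    *∈ : ∀ {a b} → U a → U b → U (a * b)
    -∈ : ∀ {a} → U a → U (- a)

module PowerSeries {c ℓ} (R : CommutativeRing c ℓ) where
  open CommutativeRing R
  open SetoidReasoning setoid
  open IntegerCoefficientSolver R

  seriesRawRing : RawRing c ℓ
  seriesRawRing = PowerSeries-rawRing rawRing

  open RawRing seriesRawRing public using ()
    renaming (Carrier to Series; _≈_ to _≋_; _+_ to _⊕_; _*_ to _⊛_; -_ to ⊝_)

  private
    const : Carrier → Series
    const = constant rawRing

    t : Series
    t = indeterminate rawRing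

  tail : Series → Series
  tail f n = f (suc n)

  -- Coefficient `n` of a product sees only the coefficients up to `n` of its factors. The bounded
  -- form is what makes the fixed-point iteration below causal.
  ⊛-cong-≤ : ∀ n {f f′ g g′ : Series} →
             (∀ k → k ℕ.≤ n → f k ≈ f′ k) → (∀ k → k ℕ.≤ n → g k ≈ g′ k) →
             (f ⊛ g) n ≈ (f′ ⊛ g′) n
  ⊛-cong-≤ zero    p q = +-congʳ (*-cong (p 0 z≤n) (q 0 z≤n))
  ⊛-cong-≤ (suc n) p q = +-cong (*-cong (p 0 z≤n) (q (suc n) ℕₚ.≤-refl))
    (⊛-cong-≤ n (λ k k≤n → p (suc k) (s≤s k≤n)) (λ k k≤n → q k (ℕₚ.m≤n⇒m≤1+n k≤n)))

  ⊛-cong : ∀ {f f′ g g′} → f ≋ f′ → g ≋ g′ → f ⊛ g ≋ f′ ⊛ g′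
  ⊛-cong p q n = ⊛-cong-≤ n (λ k _ → p k) (λ k _ → q k)

  ⊛-zero : ∀ f g → (f ⊛ g) 0 ≈ f 0 * g 0
  ⊛-zero f g = +-identityʳ _

  -- The sum in the definition unfolds by its first summand; here the last one is split off, as
  -- commutativity requires.
  ⊛-suc : ∀ n f g → (f ⊛ g) (suc n) ≈ (f ⊛ tail g) n + f (suc n) * g 0
  ⊛-suc zero    f g = solve 2 (λ a b → a :+ (b :+ con (+ 0)) := (a :+ con (+ 0)) :+ b) refl _ _
  ⊛-suc (suc n) f g = trans (+-congˡ (⊛-suc n (tail f) g)) (sym (+-assoc _ _ _))

  ⊛-comm : ∀ n f g → (f ⊛ g) n ≈ (g ⊛ f) n
  ⊛-comm zero    f g = +-congʳ (*-comm (f 0) (g 0))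
  ⊛-comm (suc n) f g = begin
    f 0 * g (suc n) + (tail f ⊛ g) n   ≈⟨ +-cong (*-comm _ _) (⊛-comm n (tail f) g) ⟩
    g (suc n) * f 0 + (g ⊛ tail f) n   ≈⟨ +-comm _ _ ⟩
    (g ⊛ tail f) n + g (suc n) * f 0   ≈⟨ ⊛-suc n g f ⟨
    (g ⊛ f) (suc n)                    ∎

  ⊛-distribʳ : ∀ n h f g → ((f ⊕ g) ⊛ h) n ≈ (f ⊛ h) n + (g ⊛ h) n
  ⊛-distribʳ zero    h f g =
    solve 3 (λ a b c → (a :+ b) :* c :+ con (+ 0) := (a :* c :+ con (+ 0)) :+ (b :* c :+ con (+ 0))) refl _ _ _
  ⊛-distribʳ (suc n) h f g = trans (+-congˡ (⊛-distribʳ n h (tail f) (tail g)))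
    (solve 5 (λ a b c p q → (a :+ b) :* c :+ (p :+ q) := (a :* c :+ p) :+ (b :* c :+ q)) refl _ _ _ _ _)

  ⊛-scale : ∀ n a f g → ((λ k → a * f k) ⊛ g) n ≈ a * (f ⊛ g) n
  ⊛-scale zero    a f g = solve 3 (λ a b c → (a :* b) :* c :+ con (+ 0) := a :* (b :* c :+ con (+ 0))) refl _ _ _
  ⊛-scale (suc n) a f g = trans (+-congˡ (⊛-scale n a (tail f) g))
    (solve 4 (λ a b c d → (a :* b) :* c :+ a :* d := a :* (b :* c :+ d)) refl _ _ _ _)

  ⊛-assoc : ∀ n f g h → ((f ⊛ g) ⊛ h) n ≈ (f ⊛ (g ⊛ h)) n
  ⊛-assoc zero    f g h =
    solve 3 (λ a b c → (a :* b :+ con (+ 0)) :* c :+ con (+ 0) := a :* (b :* c :+ con (+ 0)) :+ con (+ 0)) refl _ _ _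
  ⊛-assoc (suc n) f g h = begin
    -- `tail (f ⊛ g)` unfolds by definition to the sum of series in this line.
    (f ⊛ g) 0 * h (suc n) + (((λ k → f 0 * g (suc k)) ⊕ (tail f ⊛ g)) ⊛ h) n
      ≈⟨ +-congˡ (⊛-distribʳ n h (λ k → f 0 * g (suc k)) (tail f ⊛ g)) ⟩
    (f ⊛ g) 0 * h (suc n) + (((λ k → f 0 * g (suc k)) ⊛ h) n + ((tail f ⊛ g) ⊛ h) n)
      ≈⟨ +-congˡ (+-cong (⊛-scale n (f 0) (tail g) h) (⊛-assoc n (tail f) g h)) ⟩
    (f ⊛ g) 0 * h (suc n) + (f 0 * (tail g ⊛ h) n + (tail f ⊛ (g ⊛ h)) n)
      ≈⟨ solve 5 (λ a b c d e → (a :* b :+ con (+ 0)) :* c :+ (a :* d :+ e) := a :* (b :* c :+ d) :+ e) refl _ _ _ _ _ ⟩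
    f 0 * (g 0 * h (suc n) + (tail g ⊛ h) n) + (tail f ⊛ (g ⊛ h)) n
      ∎

  0⊛ : ∀ n f → ((λ _ → 0#) ⊛ f) n ≈ 0#
  0⊛ zero    f = trans (+-identityʳ _) (zeroˡ _)
  0⊛ (suc n) f = trans (+-cong (zeroˡ _) (0⊛ n f)) (+-identityʳ _)

  constant-⊛ : ∀ a f n → (const a ⊛ f) n ≈ a * f n
  constant-⊛ a f zero    = +-identityʳ _
  constant-⊛ a f (suc n) = trans (+-congˡ (0⊛ n f)) (+-identityʳ _)

  t⊛-suc : ∀ f n → (t ⊛ f) (suc n) ≈ f n
  t⊛-suc f n = begin
    0# * f (suc n) + (tail t ⊛ f) n   ≈⟨ +-cong (zeroˡ _) (⊛-cong {g = f} tail-t (λ _ → refl) n) ⟩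
    0# + (const 1# ⊛ f) n             ≈⟨ +-identityˡ _ ⟩
    (const 1# ⊛ f) n                  ≈⟨ constant-⊛ 1# f n ⟩
    1# * f n                          ≈⟨ *-identityˡ _ ⟩
    f n                               ∎
    where
    tail-t : tail t ≋ const 1#
    tail-t zero    = refl
    tail-t (suc n) = refl

  t⊛-zero : ∀ f → (t ⊛ f) 0 ≈ 0#
  t⊛-zero f = trans (+-identityʳ _) (zeroˡ _)

  constant-⊛-constant : ∀ a b → const a ⊛ const b ≋ const (a * b)
  constant-⊛-constant a b zero    = +-identityʳ _
  constant-⊛-constant a b (suc n) = trans (constant-⊛ a (const b) (suc n)) (zeroʳ a)

  1⊕t⊛-zero : ∀ f → (const 1# ⊕ t ⊛ f) 0 ≈ 1#
  1⊕t⊛-zero f = trans (+-congˡ (t⊛-zero f)) (+-identityʳ 1#)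

  seriesLaws : CommutativeRingLaws seriesRawRing
  seriesLaws = record
    { isEquivalence = record { refl = λ _ → refl ; sym = λ p n → sym (p n) ; trans = λ p q n → trans (p n) (q n) }
    ; +-cong        = λ p q n → +-cong (p n) (q n)
    ; +-assoc       = λ _ _ _ _ → +-assoc _ _ _
    ; +-comm        = λ _ _ _ → +-comm _ _
    ; +-identityˡ   = λ { f zero → +-identityˡ _ ; f (suc n) → +-identityˡ _ }
    ; -‿cong        = λ p n → -‿cong (p n)
    ; -‿inverseˡ    = λ { f zero → -‿inverseˡ _ ; f (suc n) → -‿inverseˡ _ }
    ; *-cong        = ⊛-cong
    ; *-assoc       = λ f g h n → ⊛-assoc n f g h
    ; *-comm        = λ f g n → ⊛-comm n f g
    ; *-identityˡ   = λ f n → trans (constant-⊛ 1# f n) (*-identityˡ _)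
    ; distribʳ      = λ h f g n → ⊛-distribʳ n h f g
    }

  seriesRing : CommutativeRing c ℓ
  seriesRing = CommutativeRingLaws.commutativeRing seriesLaws

  module _ {p q r} {U : Pred Carrier p} {V : Pred Carrier q} {W : Pred Carrier r}
           (0∈ : W 0#) (+∈ : ∀ {a b} → W a → W b → W (a + b))
           (*∈ : ∀ {a b} → U a → V b → W (a * b)) where

    -- The factors may obey different conditions: later a strict sign condition on an exponent is
    -- multiplied by a weak one.
    ⊛-closed : ∀ {f g} → (∀ n → U (f n)) → (∀ n → V (g n)) → ∀ n → W ((f ⊛ g) n)
    ⊛-closed p q zero    = +∈ (*∈ (p 0) (q 0)) 0∈
    ⊛-closed p q (suc n) = +∈ (*∈ (p 0) (q (suc n))) (⊛-closed (λ k → p (suc k)) q n)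

  module _ {p} {U : Pred Carrier p} (sub : IsSubring rawRing U) where
    open IsSubring sub

    constant∈ : ∀ {a} → U a → ∀ n → U (const a n)
    constant∈ p zero    = p
    constant∈ p (suc n) = 0∈

    indeterminate∈ : ∀ n → U (t n)
    indeterminate∈ zero          = 0∈
    indeterminate∈ (suc zero)    = 1∈
    indeterminate∈ (suc (suc n)) = 0∈

    seriesSubring : IsSubring seriesRawRing (λ f → ∀ n → U (f n))
    seriesSubring = record
      { 0∈ = constant∈ 0∈
      ; 1∈ = constant∈ 1∈
      ; +∈ = λ p q n → +∈ (p n) (q n)
      ; *∈ = ⊛-closed {U = U} {V = U} {W = U} 0∈ +∈ *∈
      ; -∈ = λ p n → -∈ (p n)
      }

  -- The equation `w = α + t (β w + γ w²)`, solved by iteration from `α`: every application of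
  -- `step` settles one more coefficient.
  module Quadratic (α β γ : Series) where

    private
      Φ step : Series → Series
      Φ w = β ⊛ w ⊕ γ ⊛ (w ⊛ w)
      step w = α ⊕ t ⊛ Φ w

      -- Multiplication by `t` shifts indices by one, so coefficient `n` of `step f` depends only on
      -- the coefficients of `f` below `n`.
      step-causal : ∀ n {f g} → (∀ k → k ℕ.< n → f k ≈ g k) → step f n ≈ step g n
      step-causal zero    {f} {g} p = +-congˡ (trans (t⊛-zero (Φ f)) (sym (t⊛-zero (Φ g))))
      step-causal (suc n) {f} {g} p = +-congˡ (begin
        (t ⊛ Φ f) (suc n)            ≈⟨ t⊛-suc (Φ f) n ⟩
        (β ⊛ f) n + (γ ⊛ (f ⊛ f)) n          ≈⟨ +-cong (⊛-cong-≤ n {β} {β} {f} {g} refl′ p′)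
                                                (⊛-cong-≤ n {γ} {γ} {f ⊛ f} {g ⊛ g} refl′ λ k k≤n →
                                                  ⊛-cong-≤ k {f} {g} {f} {g} (p″ k≤n) (p″ k≤n)) ⟩
        (β ⊛ g) n + (γ ⊛ (g ⊛ g)) n          ≈⟨ t⊛-suc (Φ g) n ⟨
        (t ⊛ Φ g) (suc n)            ∎)
        where
        refl′ : ∀ {h : Series} k → k ℕ.≤ n → h k ≈ h k
        refl′ k k≤n = refl
        p′ : ∀ k → k ℕ.≤ n → f k ≈ g k
        p′ k k≤n = p k (s≤s k≤n)
        p″ : ∀ {m} → m ℕ.≤ n → ∀ k → k ℕ.≤ m → f k ≈ g k
        p″ m≤n k k≤m = p′ k (ℕₚ.≤-trans k≤m m≤n)

      stage : ℕ → Series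
      stage zero    = α
      stage (suc n) = step (stage n)

      stage-suc : ∀ n k → k ℕ.≤ n → stage n k ≈ stage (suc n) k
      stage-suc zero    zero z≤n = sym (trans (+-congˡ (t⊛-zero (Φ α))) (+-identityʳ _))
      stage-suc (suc n) k    k≤n =
        step-causal k λ j j<k → stage-suc n j (ℕₚ.≤-pred (ℕₚ.≤-trans j<k k≤n))

      stage-stable : ∀ {k n} → k ℕ.≤′ n → stage k k ≈ stage n k
      stage-stable (ℕ.≤′-reflexive ≡.refl) = refl
      stage-stable {k} {suc n} (ℕ.≤′-step k≤n) =
        trans (stage-stable k≤n) (stage-suc n k (ℕₚ.≤′⇒≤ k≤n))

    -- The diagonal of the iteration: coefficient `n` does not change after stage `n`.
    root : Series
    root n = stage n n

    root-equation : root ≋ α ⊕ t ⊛ (β ⊛ root ⊕ γ ⊛ (root ⊛ root))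
    root-equation n = trans (stage-suc n n ℕₚ.≤-refl)
      (step-causal n λ k k<n → sym (stage-stable (ℕₚ.≤⇒≤′ (ℕₚ.<⇒≤ k<n))))

    module _ {p} {U : Pred Carrier p} (sub : IsSubring rawRing U)
             (α∈ : ∀ n → U (α n)) (β∈ : ∀ n → U (β n)) (γ∈ : ∀ n → U (γ n)) where
      open IsSubring (seriesSubring sub)

      -- Each coefficient of `root` is literally a coefficient of some stage, and stages are ring
      -- expressions in `t`, `α`, `β`, `γ`; so `U` is never transported along an equality.
      root∈ : ∀ n → U (root n)
      root∈ n = stage∈ n n
        where
        stage∈ : ∀ n k → U (stage n k)
        stage∈ zero    = α∈
        stage∈ (suc n) =
          +∈ α∈ (*∈ {t} {Φ (stage n)} (indeterminate∈ sub)
            (+∈ (*∈ {β} {stage n} β∈ (stage∈ n))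
                (*∈ {γ} {stage n ⊛ stage n} γ∈ (*∈ {stage n} {stage n} (stage∈ n) (stage∈ n)))))

-- Radicals of power series and the factorisation of the kernel

-- The interface through which the algebra below sees power series. Constant terms are replaced by
-- the relation `f ≈ 1# + t * a`.
record ContractiveRoots {c ℓ} (A : CommutativeRing c ℓ) : Set (c ⊔ ℓ) where
  open CommutativeRing A
  field
    ½             : Carrier
    2*½≈1         : (1# + 1#) * ½ ≈ 1#
    t             : Carrier
    root          : Carrier → Carrier → Carrier → Carrier
    root-equation : ∀ α β γ → let w = root α β γ in w ≈ α + t * (β * w + γ * (w * w))

record IsRootClosed {c ℓ p} {A : CommutativeRing c ℓ} (C : ContractiveRoots A)
                    (U : Pred (CommutativeRing.Carrier A) p) : Set (c ⊔ p) where
  open ContractiveRoots C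
  field
    isSubring : IsSubring (CommutativeRing.rawRing A) U
    ½∈        : U ½
    t∈        : U t
    root∈     : ∀ {α β γ} → U α → U β → U γ → U (root α β γ)
  open IsSubring isSubring public

module Radicals {c ℓ} {A : CommutativeRing c ℓ} (C : ContractiveRoots A) where
  open CommutativeRing A
  open ContractiveRoots C
  open IntegerCoefficientSolver A
  open SetoidReasoning setoid

  -- Identities modulo hypotheses l ≈ r: p - q is exhibited as a combination of the l - r.
  vanish : ∀ {p q l r} c → l ≈ r → p ≈ q + c * (l - r) → p ≈ q
  vanish {p} {q} {l} {r} c l≈r eq = begin
    p                  ≈⟨ eq ⟩
    q + c * (l - r)    ≈⟨ +-congˡ (*-congˡ (+-congʳ l≈r)) ⟩
    q + c * (r - r)    ≈⟨ solve 3 (λ q c r → q :+ c :* (r :- r) := q) refl q c r ⟩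
    q                  ∎

  Unital : Carrier → Set (c ⊔ ℓ)
  Unital f = ∃[ a ] f ≈ 1# + t * a

  Unital-* : ∀ {f g} → Unital f → Unital g → Unital (f * g)
  Unital-* (a , p) (b , q) = a + b + t * (a * b) , trans (*-cong p q)
    (solve 3 (λ t a b → (con (+ 1) :+ t :* a) :* (con (+ 1) :+ t :* b)
                      := con (+ 1) :+ t :* (a :+ b :+ t :* (a :* b))) refl t a b)

  geometric : Carrier → Carrier
  geometric b = root 1# b 0#

  geometric-step : ∀ b → geometric b ≈ 1# + t * (b * geometric b)
  geometric-step b = trans (root-equation 1# b 0#)
    (solve 3 (λ t b g → con (+ 1) :+ t :* (b :* g :+ con (+ 0) :* (g :* g)) := con (+ 1) :+ t :* (b :* g))
      refl t b (geometric b))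

  geometric-inverse : ∀ b → (1# - t * b) * geometric b ≈ 1#
  geometric-inverse b = vanish 1# (geometric-step b)
    (solve 3 (λ t b g → (con (+ 1) :- t :* b) :* g
                      := con (+ 1) :+ con (+ 1) :* (g :- (con (+ 1) :+ t :* (b :* g)))) refl t b (geometric b))

  -- The root w of 2w + t p w² = a, so that (1 + t p w)² = 1 + t p a.
  sqrtPart : Carrier → Carrier → Carrier
  sqrtPart p a = root (½ * a) 0# (- (½ * p))

  -- The factor `p` is kept apart from `a` so that it stays visible in the root itself; with `p = x`
  -- it will show that all terms but 1 carry a positive power of `x`.
  sqrt1+ : Carrier → Carrier → Carrier
  sqrt1+ p a = 1# + t * (p * sqrtPart p a)

  sqrt1+-square : ∀ p a → sqrt1+ p a * sqrt1+ p a ≈ 1# + t * (p * a)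
  sqrt1+-square p a = vanish ((1# + 1#) * t * p) (root-equation (½ * a) 0# (- (½ * p)))
    (vanish (t * p * (a - t * p * (w * w))) 2*½≈1
      (solve 5 (λ t p a h w →
          (con (+ 1) :+ t :* (p :* w)) :* (con (+ 1) :+ t :* (p :* w))
        := con (+ 1) :+ t :* (p :* a)
           :+ con (+ 2) :* t :* p :* (w :- (h :* a :+ t :* (con (+ 0) :* w :+ :- (h :* p) :* (w :* w))))
           :+ t :* p :* (a :- t :* p :* (w :* w)) :* (con (+ 2) :* h :- con (+ 1)))
        refl t p a ½ w))
    where
    w : Carrier
    w = sqrtPart p a

  -- The difference of the squares is `(f - g)(f + g)`, and half of `f + g` is `1 - t d`, which
  -- `geometric` inverts.
  sqrt-unique : ∀ {f g} → Unital f → Unital g → f * f ≈ g * g → f ≈ g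
  sqrt-unique {f} {g} (a , p) (b , q) f²≈g² =
    vanish (- (f - g)) (geometric-inverse d)
    (vanish (z * ½) f²≈g²
    (vanish (- (z * (f - g) * ½)) (+-cong p q)
    (vanish (- (z * (f - g))) 2*½≈1 (solve 7 (λ t a b h f g z →
      f := g :+ :- (f :- g) :* ((con (+ 1) :- t :* :- (h :* (a :+ b))) :* z :- con (+ 1))
             :+ z :* h :* (f :* f :- g :* g)
             :+ :- (z :* (f :- g) :* h) :* ((f :+ g) :- ((con (+ 1) :+ t :* a) :+ (con (+ 1) :+ t :* b)))
             :+ :- (z :* (f :- g)) :* (con (+ 2) :* h :- con (+ 1))) refl t a b ½ f g z))))
    where
    d z : Carrier
    d = - (½ * (a + b))
    z = geometric d

  module _ {p} {U : Pred Carrier p} (closed : IsRootClosed C U) where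
    open IsRootClosed closed

    geometric∈ : ∀ {b} → U b → U (geometric b)
    geometric∈ b∈ = root∈ 1∈ b∈ 0∈

    sqrtPart∈ : ∀ {p a} → U p → U a → U (sqrtPart p a)
    sqrtPart∈ p∈ a∈ = root∈ (*∈ ½∈ a∈) 0∈ (-∈ (*∈ ½∈ p∈))

    sqrt1+∈ : ∀ {p a} → U p → U a → U (sqrt1+ p a)
    sqrt1+∈ p∈ a∈ = +∈ 1∈ (*∈ t∈ (*∈ p∈ (sqrtPart∈ p∈ a∈)))

  -- One factor of `Δ` and its radicals

  module Factor (v : Carrier) where

    -- The root of t(1 + θ²) = (1 - 2tv)θ with θ(0) = 0, so that 1/θ is the other root.
    -- In the notation below θ = t φ, e = 1 - 2tv - tθ and √δ = 1 - 2tv - 2tθ.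
    θ : Carrier
    θ = root t ((1# + 1#) * v) 1#

    φ e √δ : Carrier
    φ  = 1# + ((1# + 1#) * v * θ + θ * θ)
    e  = 1# + t * (- ((1# + 1#) * v + θ))
    √δ = 1# + t * (- ((1# + 1#) * (v + θ)))

    √e : Carrier
    √e = sqrt1+ 1# (- ((1# + 1#) * v + θ))

    -- The square root of `1 - p θ`; writing `θ` as `t φ` brings this radicand into the form
    -- `1 + t p a`.
    ρ : Carrier → Carrier
    ρ p = sqrt1+ p (- φ)

    θ-equation : θ ≈ t + t * ((1# + 1#) * v * θ + 1# * (θ * θ))
    θ-equation = root-equation t ((1# + 1#) * v) 1#

    -- The right side is the discriminant `(1 - 2tv)² - 4t²` of the quadratic for `θ`, and
    -- `√δ = (1 - 2tv) - 2tθ` is its root.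
    √δ-square : √δ * √δ ≈ (1# - (1# + 1#) * t * (1# + v)) * (1# + (1# + 1#) * t * (1# - v))
    √δ-square = vanish (- ((1# + 1#) * (1# + 1#) * t)) θ-equation (solve 3 (λ t v θ →
      let √δ = con (+ 1) :+ t :* (:- (con (+ 2) :* (v :+ θ))) in
      √δ :* √δ := (con (+ 1) :- con (+ 2) :* t :* (con (+ 1) :+ v)) :* (con (+ 1) :+ con (+ 2) :* t :* (con (+ 1) :- v))
        :+ :- (con (+ 2) :* con (+ 2) :* t)
           :* (θ :- (t :+ t :* (con (+ 2) :* v :* θ :+ con (+ 1) :* (θ :* θ))))) refl t v θ)

    √e-square : √e * √e ≈ e
    √e-square = trans (sqrt1+-square _ _) (+-congˡ (*-congˡ (*-identityˡ _)))

    ρ-square : ∀ p → ρ p * ρ p ≈ 1# - p * θ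
    ρ-square p = trans (sqrt1+-square p (- φ)) (vanish p θ-equation (solve 4 (λ t v θ p →
      con (+ 1) :+ t :* (p :* (:- (con (+ 1) :+ (con (+ 2) :* v :* θ :+ θ :* θ))))
        := con (+ 1) :- p :* θ
           :+ p :* (θ :- (t :+ t :* (con (+ 2) :* v :* θ :+ con (+ 1) :* (θ :* θ))))) refl t v θ p))

    -- The equation of `θ` says `e θ = t`, so `2e (1 - p θ) = 2e - 2tp`, and `2e = 1 - 2tv + √δ`.
    radicand : ∀ p → let r = √e * ρ p in
               (1# + 1#) * (r * r) ≈ 1# - (1# + 1#) * t * (v + p) + √δ
    radicand p =
      vanish (1# + 1# - (1# + 1#) * p * θ) √e-square
      (vanish ((1# + 1#) * (√e * √e)) (ρ-square p)
      (vanish (- ((1# + 1#) * p)) θ-equation (solve 6 (λ t v θ p s r →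
        let e = con (+ 1) :+ t :* (:- (con (+ 2) :* v :+ θ)) in
        con (+ 2) :* ((s :* r) :* (s :* r))
          := con (+ 1) :- con (+ 2) :* t :* (v :+ p) :+ (con (+ 1) :+ t :* (:- (con (+ 2) :* (v :+ θ))))
             :+ (con (+ 1) :+ con (+ 1) :- con (+ 2) :* p :* θ) :* (s :* s :- e)
             :+ con (+ 2) :* (s :* s) :* (r :* r :- (con (+ 1) :- p :* θ))
             :+ :- (con (+ 2) :* p)
                :* (θ :- (t :+ t :* (con (+ 2) :* v :* θ :+ con (+ 1) :* (θ :* θ)))))
        refl t v θ p √e (ρ p))))

    -- For `p q = 1` the square is `e (1 + θ²) - e θ (p + q)`; here `e θ = t`, hence also
    -- `e (1 + θ²) = e + t θ = 1 - 2tv`.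
    factorisation : ∀ {p q} → p * q ≈ 1# → let s = √e * ρ q * ρ p in
                    s * s ≈ 1# - t * (p + q) - (1# + 1#) * t * v
    factorisation {p} {q} pq≈1 =
      vanish (ρ q * ρ q * (ρ p * ρ p)) √e-square
      (vanish (e * (ρ p * ρ p)) (ρ-square q)
      (vanish (e * (1# - q * θ)) (ρ-square p)
      (vanish (e * (θ * θ)) pq≈1
      (vanish (θ - (p + q)) θ-equation (solve 8 (λ t v θ p q s r r′ →
        let e = con (+ 1) :+ t :* (:- (con (+ 2) :* v :+ θ)) in
        (s :* r′ :* r) :* (s :* r′ :* r)
          := con (+ 1) :- t :* (p :+ q) :- con (+ 2) :* t :* v
             :+ r′ :* r′ :* (r :* r) :* (s :* s :- e)
             :+ e :* (r :* r) :* (r′ :* r′ :- (con (+ 1) :- q :* θ))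
             :+ e :* (con (+ 1) :- q :* θ) :* (r :* r :- (con (+ 1) :- p :* θ))
             :+ e :* (θ :* θ) :* (p :* q :- con (+ 1))
             :+ (θ :- (p :+ q))
                :* (θ :- (t :+ t :* (con (+ 2) :* v :* θ :+ con (+ 1) :* (θ :* θ)))))
        refl t v θ p q √e (ρ p) (ρ q))))))

    √δ-unital : Unital √δ
    √δ-unital = _ , refl

    √e-unital : Unital √e
    √e-unital = _ , refl

    ρ-unital : ∀ p → Unital (ρ p)
    ρ-unital p = _ , refl

    ρ⁻¹ : Carrier → Carrier
    ρ⁻¹ p = geometric (- (p * sqrtPart p (- φ)))

    ρ-inverse : ∀ p → ρ p * ρ⁻¹ p ≈ 1#
    ρ-inverse p = trans (*-congʳ (solve 2 (λ t a → con (+ 1) :+ t :* a := con (+ 1) :- t :* (:- a)) refl _ _))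
                        (geometric-inverse _)

    ζ : Carrier → Carrier
    ζ p = - (t * (sqrtPart p (- φ) * ρ⁻¹ p))

    -- One step of the geometric series exposes the factor `p`. For `p = x` everything except 1 is
    -- thereby a multiple of `x`.
    ρ⁻¹-expansion : ∀ p → ρ⁻¹ p ≈ 1# + p * ζ p
    ρ⁻¹-expansion p = trans (geometric-step _)
      (solve 4 (λ t p w g → con (+ 1) :+ t :* (:- (p :* w) :* g) := con (+ 1) :+ p :* (:- (t :* (w :* g))))
        refl t p (sqrtPart p (- φ)) (ρ⁻¹ p))

    module _ {q} {U : Pred Carrier q} (closed : IsRootClosed C U) (v∈ : U v) where
      open IsRootClosed closed

      private
        2v∈ : U ((1# + 1#) * v)
        2v∈ = *∈ (+∈ 1∈ 1∈) v∈

        θ∈ : U θ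
        θ∈ = root∈ t∈ 2v∈ 1∈

        -φ∈ : U (- φ)
        -φ∈ = -∈ (+∈ 1∈ (+∈ (*∈ 2v∈ θ∈) (*∈ θ∈ θ∈)))

      √e∈ : U √e
      √e∈ = sqrt1+∈ closed 1∈ (-∈ (+∈ 2v∈ θ∈))

      ρ∈ : ∀ {p} → U p → U (ρ p)
      ρ∈ p∈ = sqrt1+∈ closed p∈ -φ∈

      ρ⁻¹∈ : ∀ {p} → U p → U (ρ⁻¹ p)
      ρ⁻¹∈ p∈ = geometric∈ closed (-∈ (*∈ p∈ (sqrtPart∈ closed p∈ -φ∈)))

      ζ∈ : ∀ {p} → U p → U (ζ p)
      ζ∈ p∈ = -∈ (*∈ t∈ (*∈ (sqrtPart∈ closed p∈ -φ∈) (ρ⁻¹∈ p∈)))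

  -- Wiener-Hopf factorisation of the kernel

  module WienerHopf (x x̄ y ȳ v √two : Carrier)
                   (xx̄≈1 : x * x̄ ≈ 1#) (yȳ≈1 : y * ȳ ≈ 1#) (√two-square : √two * √two ≈ 1# + 1#)
                   where
    module F₁ = Factor v
    module F₂ = Factor (- v)

    H : Carrier
    H = F₁.√e * F₁.ρ x̄ * (F₂.√e * F₂.ρ x̄)

    E : Carrier
    E = F₁.ρ⁻¹ x * F₂.ρ⁻¹ x

    Z : Carrier
    Z = F₁.ζ x + F₂.ζ x + x * (F₁.ζ x * F₂.ζ x)

    E-expansion : E ≈ 1# + x * Z
    E-expansion = trans (*-cong (F₁.ρ⁻¹-expansion x) (F₂.ρ⁻¹-expansion x))
      (solve 3 (λ x a b → (con (+ 1) :+ x :* a) :* (con (+ 1) :+ x :* b)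
                        := con (+ 1) :+ x :* (a :+ b :+ x :* (a :* b))) refl x (F₁.ζ x) (F₂.ζ x))

    -- The root of tv(1 + Y²) = (1 - t(x + x̄))Y with Y(0) = 0: the kernel is
    -- proportional to (1 - Yy)(1 - Yȳ).
    Y ψ : Carrier
    Y = root (t * v) (x + x̄) v
    ψ = v + ((x + x̄) * Y + v * (Y * Y))

    Y-equation : Y ≈ t * v + t * ((x + x̄) * Y + v * (Y * Y))
    Y-equation = root-equation (t * v) (x + x̄) v

    Y≈tψ : Y ≈ t * ψ
    Y≈tψ = trans Y-equation (sym (distribˡ t v _))

    -- This is `√Δ`, obtained from the quadratic for `Y` in the same way as `√δ` from the quadratic
    -- for `θ`.
    s : Carrier
    s = 1# - t * (x + x̄) - (1# + 1#) * t * v * Y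

    s-square : s * s ≈ (1# - t * (x + x̄) - (1# + 1#) * t * v) * (1# - t * (x + x̄) + (1# + 1#) * t * v)
    s-square = vanish (- ((1# + 1#) * (1# + 1#) * t * v)) Y-equation (solve 4 (λ t v X Y →
      let u = con (+ 1) :- t :* X
          s = u :- con (+ 2) :* t :* v :* Y in
      s :* s := (u :- con (+ 2) :* t :* v) :* (u :+ con (+ 2) :* t :* v)
        :+ :- (con (+ 2) :* con (+ 2) :* t :* v) :* (Y :- (t :* v :+ t :* (X :* Y :+ v :* (Y :* Y)))))
      refl t v (x + x̄) Y)

    -- Both sides are square roots of `Δ` with constant term 1: the left one comes from factoring
    -- the kernel in `y`, the right one from factoring `Δ` in `x`.
    s≈ : s ≈ H * (F₁.ρ x * F₂.ρ x)
    s≈ = trans (sqrt-unique s-unital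
        (Unital-* (Unital-* (Unital-* F₁.√e-unital (F₁.ρ-unital x̄)) (F₁.ρ-unital x))
                  (Unital-* (Unital-* F₂.√e-unital (F₂.ρ-unital x̄)) (F₂.ρ-unital x)))
        (begin
          s * s
            ≈⟨ s-square ⟩
          (1# - t * (x + x̄) - (1# + 1#) * t * v) * (1# - t * (x + x̄) + (1# + 1#) * t * v)
            ≈⟨ *-congˡ (solve 3 (λ t v X → con (+ 1) :- t :* X :+ con (+ 2) :* t :* v
                                         := con (+ 1) :- t :* X :- con (+ 2) :* t :* (:- v)) refl t v (x + x̄)) ⟩
          (1# - t * (x + x̄) - (1# + 1#) * t * v) * (1# - t * (x + x̄) - (1# + 1#) * t * (- v))
            ≈⟨ *-cong (F₁.factorisation xx̄≈1) (F₂.factorisation xx̄≈1) ⟨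
          a * a * (b * b)
            ≈⟨ solve 2 (λ a b → a :* a :* (b :* b) := a :* b :* (a :* b)) refl a b ⟩
          a * b * (a * b)
            ∎))
      (solve 6 (λ a b c d e f → (a :* b :* c) :* (d :* e :* f) := (a :* b :* (d :* e)) :* (c :* f))
        refl _ _ _ _ _ _)
      where
      a b : Carrier
      a = F₁.√e * F₁.ρ x̄ * F₁.ρ x
      b = F₂.√e * F₂.ρ x̄ * F₂.ρ x
      s-unital : Unital s
      s-unital = - (x + x̄ + (1# + 1#) * v * Y) ,
        solve 4 (λ t v X Y → con (+ 1) :- t :* X :- con (+ 2) :* t :* v :* Y
                           := con (+ 1) :+ t :* (:- (X :+ con (+ 2) :* v :* Y))) refl t v (x + x̄) Y

    X k G : Carrier
    X = x + x̄ + y * v + ȳ * v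
    k = geometric X
    G = H * k

    G-step : G ≈ H + t * (X * G)
    G-step = trans (*-congˡ (geometric-step X))
      (solve 4 (λ t h X k → h :* (con (+ 1) :+ t :* (X :* k)) := h :+ t :* (X :* (h :* k))) refl t H X k)

    -- The inverses of `1 - Y y` and `1 - Y ȳ`, since `Y = t ψ`.
    P Q : Carrier
    P = geometric (ψ * y)
    Q = geometric (ψ * ȳ)

    private
      -- The partial fraction expansion in `y` of `(1 - Y²) / ((1 - Y y)(1 - Y ȳ))`: it separates
      -- positive from negative powers of `y` and has 1 as its part free of `y`.
      J : Carrier
      J = 1# + Y * y * P + Y * ȳ * Q

      P-inverse : ∀ z → (1# - Y * z) * geometric (ψ * z) ≈ 1#
      P-inverse z = trans
        (*-congʳ (+-congˡ (-‿cong (trans (*-congʳ Y≈tψ) (*-assoc t ψ z)))))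
        (geometric-inverse (ψ * z))

      ε D : Carrier
      ε = 1# - t * (x + x̄) - t * v * Y
      D = (1# - Y * y) * (1# - Y * ȳ)

      -- The equation of `Y` says `ε Y = t v`, hence `ε (1 + Y²) = 1 - t (x + x̄)`; expand `D` using
      -- `y ȳ = 1`.
      kernel-factorisation : 1# - t * X ≈ ε * D
      kernel-factorisation =
        vanish (y + ȳ - Y) Y-equation
        (vanish (- (ε * (Y * Y))) yȳ≈1 (solve 7 (λ t v x x̄ y ȳ Y →
          let ε = con (+ 1) :- t :* (x :+ x̄) :- t :* v :* Y in
          con (+ 1) :- t :* (x :+ x̄ :+ y :* v :+ ȳ :* v)
            := ε :* ((con (+ 1) :- Y :* y) :* (con (+ 1) :- Y :* ȳ))
               :+ (y :+ ȳ :- Y) :* (Y :- (t :* v :+ t :* ((x :+ x̄) :* Y :+ v :* (Y :* Y))))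
               :+ :- (ε :* (Y :* Y)) :* (y :* ȳ :- con (+ 1)))
          refl t v x x̄ y ȳ Y))

      D*J : D * J ≈ 1# - Y * Y
      D*J =
        vanish (Y * y * (1# - Y * ȳ)) (P-inverse y)
        (vanish (Y * ȳ * (1# - Y * y)) (P-inverse ȳ)
        (vanish (- (Y * Y)) yȳ≈1 (solve 5 (λ y ȳ Y P Q →
          let a = con (+ 1) :- Y :* y
              b = con (+ 1) :- Y :* ȳ in
          a :* b :* (con (+ 1) :+ Y :* y :* P :+ Y :* ȳ :* Q)
            := con (+ 1) :- Y :* Y
               :+ Y :* y :* b :* (a :* P :- con (+ 1))
               :+ Y :* ȳ :* a :* (b :* Q :- con (+ 1))
               :+ :- (Y :* Y) :* (y :* ȳ :- con (+ 1)))
          refl y ȳ Y P Q)))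

      ε*[1-Y²] : ε * (1# - Y * Y) ≈ s
      ε*[1-Y²] = vanish (- Y) Y-equation (solve 4 (λ t v X Y →
          (con (+ 1) :- t :* X :- t :* v :* Y) :* (con (+ 1) :- Y :* Y)
            := con (+ 1) :- t :* X :- con (+ 2) :* t :* v :* Y
               :+ :- Y :* (Y :- (t :* v :+ t :* (X :* Y :+ v :* (Y :* Y)))))
          refl t v (x + x̄) Y)

      -- In other words `1/K = J / √Δ`.
      kernel*J : (1# - t * X) * J ≈ s
      kernel*J = begin
        (1# - t * X) * J      ≈⟨ *-congʳ kernel-factorisation ⟩
        ε * D * J             ≈⟨ *-assoc ε D J ⟩
        ε * (D * J)           ≈⟨ *-congˡ D*J ⟩
        ε * (1# - Y * Y)      ≈⟨ ε*[1-Y²] ⟩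
        s                     ∎

    -- Since `G = H J / s` and `s` is `H` times the two radicals in `x`, the factor `H` cancels and
    -- `G = E J`.
    G-expansion : G ≈ E + y * (E * Y * P) + ȳ * (E * Y * Q)
    G-expansion = sym (begin
      E + y * (E * Y * P) + ȳ * (E * Y * Q)
        ≈⟨ solve 6 (λ E y ȳ Y P Q → E :+ y :* (E :* Y :* P) :+ ȳ :* (E :* Y :* Q)
                                  := E :* (con (+ 1) :+ Y :* y :* P :+ Y :* ȳ :* Q)) refl E y ȳ Y P Q ⟩
      E * J                                           ≈⟨ *-identityʳ _ ⟨
      E * J * 1#                                      ≈⟨ *-congˡ (geometric-inverse X) ⟨
      E * J * ((1# - t * X) * k)
        ≈⟨ solve 4 (λ E J D k → E :* J :* (D :* k) := D :* J :* (E :* k)) refl E J (1# - t * X) k ⟩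
      (1# - t * X) * J * (E * k)                      ≈⟨ *-congʳ (trans kernel*J s≈) ⟩
      H * (F₁.ρ x * F₂.ρ x) * (E * k)
        ≈⟨ solve 6 (λ H a b c d k → H :* (a :* b) :* (c :* d :* k) := (a :* c) :* (b :* d) :* (H :* k)) refl H _ _ _ _ k ⟩
      F₁.ρ x * F₁.ρ⁻¹ x * (F₂.ρ x * F₂.ρ⁻¹ x) * G     ≈⟨ *-congʳ (*-cong (F₁.ρ-inverse x) (F₂.ρ-inverse x)) ⟩
      1# * 1# * G                                     ≈⟨ trans (*-congʳ (*-identityˡ _)) (*-identityˡ _) ⟩
      G                                               ∎)

    -- By `radicand` the squares of the products without `√two` are half the radicands of the
    -- statement. Together the two `√two` give 2, which cancels against `½`.
    √A √B D⁻¹ : Carrier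
    √A  = √two * (F₁.√e * F₁.ρ x̄)
    √B  = √two * (F₂.√e * F₂.ρ x̄)
    D⁻¹ = ½ * k

    private
      √two*-square : ∀ {a b} → (1# + 1#) * (a * a) ≈ b → √two * a * (√two * a) ≈ b
      √two*-square {a} {b} p = vanish 1# p (vanish (a * a) √two-square (solve 3 (λ r a b →
        r :* a :* (r :* a) := b :+ con (+ 1) :* (con (+ 2) :* (a :* a) :- b)
                              :+ a :* a :* (r :* r :- con (+ 2))) refl √two a b))

    √δ₂-square : F₂.√δ * F₂.√δ ≈ (1# - (1# + 1#) * t * (1# - v)) * (1# + (1# + 1#) * t * (1# + v))
    √δ₂-square = trans F₂.√δ-square (solve 2 (λ t v →
         (con (+ 1) :- con (+ 2) :* t :* (con (+ 1) :- v)) :* (con (+ 1) :+ con (+ 2) :* t :* (con (+ 1) :- :- v))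
      := (con (+ 1) :- con (+ 2) :* t :* (con (+ 1) :- v)) :* (con (+ 1) :+ con (+ 2) :* t :* (con (+ 1) :+ v)))
      refl t v)

    √A-square : √A * √A ≈ 1# - (1# + 1#) * t * (v + x̄) + F₁.√δ
    √A-square = √two*-square (F₁.radicand x̄)

    √B-square : √B * √B ≈ 1# + (1# + 1#) * t * (v - x̄) + F₂.√δ
    √B-square = √two*-square (trans (F₂.radicand x̄) (+-congʳ (solve 3 (λ t v p →
         con (+ 1) :- con (+ 2) :* t :* (:- v :+ p) := con (+ 1) :+ con (+ 2) :* t :* (v :- p)) refl t v x̄)))

    D⁻¹-inverse : (1# + 1#) * (1# - t * X) * D⁻¹ ≈ 1#
    D⁻¹-inverse = vanish 1# (geometric-inverse X) (vanish ((1# - t * X) * k) 2*½≈1 (solve 3 (λ d k h →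
      con (+ 2) :* d :* (h :* k) := con (+ 1) :+ con (+ 1) :* (d :* k :- con (+ 1))
                                    :+ d :* k :* (con (+ 2) :* h :- con (+ 1))) refl (1# - t * X) k ½))

    √A*√B*D⁻¹≈G : √A * √B * D⁻¹ ≈ G
    √A*√B*D⁻¹≈G = vanish (a * b * ½ * k) √two-square (vanish (a * b * k) 2*½≈1 (solve 5 (λ r a b h k →
      r :* a :* (r :* b) :* (h :* k)
        := a :* b :* k :+ a :* b :* h :* k :* (r :* r :- con (+ 2))
           :+ a :* b :* k :* (con (+ 2) :* h :- con (+ 1))) refl √two a b ½ k))
      where
      a b : Carrier
      a = F₁.√e * F₁.ρ x̄
      b = F₂.√e * F₂.ρ x̄

    module _ {q} {U : Pred Carrier q} (closed : IsRootClosed C U) (v∈ : U v) where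
      open IsRootClosed closed

      private
        -v∈ : U (- v)
        -v∈ = -∈ v∈

      -- `H` is generated from `v` and `x̄`, so `U` may be a condition that fails for `x`, such as
      -- lying on `ℋ`. Dually, `E` and `Z` are generated from `v` and `x`.
      H∈ : U x̄ → U H
      H∈ x̄∈ = *∈ (*∈ (F₁.√e∈ closed v∈) (F₁.ρ∈ closed v∈ x̄∈))
                 (*∈ (F₂.√e∈ closed -v∈) (F₂.ρ∈ closed -v∈ x̄∈))

      E∈ : U x → U E
      E∈ x∈ = *∈ (F₁.ρ⁻¹∈ closed v∈ x∈) (F₂.ρ⁻¹∈ closed -v∈ x∈)

      Z∈ : U x → U Z
      Z∈ x∈ = +∈ (+∈ ζ₁∈ ζ₂∈) (*∈ x∈ (*∈ ζ₁∈ ζ₂∈))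
        where
        ζ₁∈ = F₁.ζ∈ closed v∈ x∈
        ζ₂∈ = F₂.ζ∈ closed -v∈ x∈

      module _ (x∈ : U x) (x̄∈ : U x̄) where
        private
          Y∈ : U Y
          Y∈ = root∈ (*∈ t∈ v∈) (+∈ x∈ x̄∈) v∈

          ψ∈ : U ψ
          ψ∈ = +∈ v∈ (+∈ (*∈ (+∈ x∈ x̄∈) Y∈) (*∈ v∈ (*∈ Y∈ Y∈)))

        E*Y*geometric∈ : ∀ {z} → U z → U (E * Y * geometric (ψ * z))
        E*Y*geometric∈ z∈ = *∈ (*∈ (E∈ x∈) Y∈) (geometric∈ closed (*∈ ψ∈ z∈))

-- The ring of Laurent polynomials over ℚ(√2)

ℚ√2-laws : CommutativeRingLaws ℚ√2-rawRing
ℚ√2-laws = record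
  { isEquivalence = ≡.isEquivalence
  ; +-cong        = cong₂ _
  ; +-assoc       = λ (a + a′ √2) (b + b′ √2) (c + c′ √2) → cong₂ _+_√2 (ℚₚ.+-assoc a b c) (ℚₚ.+-assoc a′ b′ c′)
  ; +-comm        = λ (a + a′ √2) (b + b′ √2) → cong₂ _+_√2 (ℚₚ.+-comm a b) (ℚₚ.+-comm a′ b′)
  ; +-identityˡ   = λ (a + a′ √2) → cong₂ _+_√2 (ℚₚ.+-identityˡ a) (ℚₚ.+-identityˡ a′)
  ; -‿cong        = cong (RawRing.-_ ℚ√2-rawRing)
  ; -‿inverseˡ    = λ (a + a′ √2) → cong₂ _+_√2 (ℚₚ.+-inverseˡ a) (ℚₚ.+-inverseˡ a′)
  ; *-cong        = cong₂ _
  ; *-assoc       = λ (a + a′ √2) (b + b′ √2) (c + c′ √2) → cong₂ _+_√2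
      (solve 6 (λ a a′ b b′ c c′ →
           (a :* b :+ (a′ :* b′ :+ a′ :* b′)) :* c
             :+ ((a :* b′ :+ a′ :* b) :* c′ :+ (a :* b′ :+ a′ :* b) :* c′)
        := a :* (b :* c :+ (b′ :* c′ :+ b′ :* c′))
             :+ (a′ :* (b :* c′ :+ b′ :* c) :+ a′ :* (b :* c′ :+ b′ :* c)))
        ≡.refl a a′ b b′ c c′)
      (solve 6 (λ a a′ b b′ c c′ →
           (a :* b :+ (a′ :* b′ :+ a′ :* b′)) :* c′ :+ (a :* b′ :+ a′ :* b) :* c
        := a :* (b :* c′ :+ b′ :* c) :+ a′ :* (b :* c :+ (b′ :* c′ :+ b′ :* c′)))
        ≡.refl a a′ b b′ c c′)
  ; *-comm        = λ (a + a′ √2) (b + b′ √2) → cong₂ _+_√2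
      (solve 4 (λ a a′ b b′ → a :* b :+ (a′ :* b′ :+ a′ :* b′) := b :* a :+ (b′ :* a′ :+ b′ :* a′)) ≡.refl a a′ b b′)
      (solve 4 (λ a a′ b b′ → a :* b′ :+ a′ :* b := b :* a′ :+ b′ :* a) ≡.refl a a′ b b′)
  ; *-identityˡ   = λ (a + a′ √2) → cong₂ _+_√2
      (solve 2 (λ a a′ → con (+ 1) :* a :+ (con (+ 0) :* a′ :+ con (+ 0) :* a′) := a) ≡.refl a a′)
      (solve 2 (λ a a′ → con (+ 1) :* a′ :+ con (+ 0) :* a := a′) ≡.refl a a′)
  ; distribʳ      = λ (c + c′ √2) (a + a′ √2) (b + b′ √2) → cong₂ _+_√2
      (solve 6 (λ a a′ b b′ c c′ →
           (a :+ b) :* c :+ ((a′ :+ b′) :* c′ :+ (a′ :+ b′) :* c′)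
        := (a :* c :+ (a′ :* c′ :+ a′ :* c′)) :+ (b :* c :+ (b′ :* c′ :+ b′ :* c′)))
        ≡.refl a a′ b b′ c c′)
      (solve 6 (λ a a′ b b′ c c′ →
           (a :+ b) :* c′ :+ (a′ :+ b′) :* c := (a :* c′ :+ a′ :* c) :+ (b :* c′ :+ b′ :* c))
        ≡.refl a a′ b b′ c c′)
  }
  where open IntegerCoefficientSolver ℚₚ.+-*-commutativeRing

ℚ√2-ring : CommutativeRing 0ℓ 0ℓ
ℚ√2-ring = CommutativeRingLaws.commutativeRing ℚ√2-laws

·ᴹ-comm : ∀ m n → m ·ᴹ n ≡ n ·ᴹ m
·ᴹ-comm (i , j , k) (i′ , j′ , k′) = cong₂ _,_ (ℤₚ.+-comm i i′) (cong₂ _,_ (ℤₚ.+-comm j j′) (ℕₚ.+-comm k k′))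

·ᴹ-assoc : ∀ l m n → (l ·ᴹ m) ·ᴹ n ≡ l ·ᴹ (m ·ᴹ n)
·ᴹ-assoc (i , j , k) (i′ , j′ , k′) (i″ , j″ , k″) =
  cong₂ _,_ (ℤₚ.+-assoc i i′ i″) (cong₂ _,_ (ℤₚ.+-assoc j j′ j″) (ℕₚ.+-assoc k k′ k″))

·ᴹ-identityˡ : ∀ m → (0ℤ , 0ℤ , 0) ·ᴹ m ≡ m
·ᴹ-identityˡ (i , j , k) = cong₂ _,_ (ℤₚ.+-identityˡ i) (cong₂ _,_ (ℤₚ.+-identityˡ j) ≡.refl)

-- Exponents of `x` and `y` are integers and can always be subtracted; the exponent of `v` is a
-- natural number and decides whether a quotient exists.
·ᴹ-quotient : ∀ m b → (∃[ n ] ∀ a → (a ·ᴹ b ≡ m ⇔ a ≡ n)) ⊎ (∀ a → a ·ᴹ b ≢ m)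
·ᴹ-quotient (i , j , k) (i′ , j′ , k′) with k′ ℕ.≤? k
... | no k′≰k  = inj₂ λ { (_ , _ , l) ≡.refl → k′≰k (ℕₚ.m≤n+m k′ l) }
... | yes k′≤k = inj₁ ((i ℤ.- i′ , j ℤ.- j′ , k ℕ.∸ k′) , λ a → mk⇔ (to a) (from a))
  where
  +- : ∀ a b → (a ℤ.+ b) ℤ.- b ≡ a
  +- a b = ≡.trans (ℤₚ.+-assoc a b (ℤ.- b)) (≡.trans (cong (λ z → a ℤ.+ z) (ℤₚ.+-inverseʳ b)) (ℤₚ.+-identityʳ a))
  -+ : ∀ a b → (a ℤ.- b) ℤ.+ b ≡ a
  -+ a b = ≡.trans (ℤₚ.+-assoc a (ℤ.- b) b) (≡.trans (cong (λ z → a ℤ.+ z) (ℤₚ.+-inverseˡ b)) (ℤₚ.+-identityʳ a))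
  to : ∀ a → a ·ᴹ (i′ , j′ , k′) ≡ (i , j , k) → a ≡ (i ℤ.- i′ , j ℤ.- j′ , k ℕ.∸ k′)
  to (a , b , c) ≡.refl = ≡.sym (cong₂ _,_ (+- a i′) (cong₂ _,_ (+- b j′) (ℕₚ.m+n∸n≡m c k′)))
  from : ∀ a → a ≡ (i ℤ.- i′ , j ℤ.- j′ , k ℕ.∸ k′) → a ·ᴹ (i′ , j′ , k′) ≡ (i , j , k)
  from _ ≡.refl = cong₂ _,_ (-+ i i′) (cong₂ _,_ (-+ j j′) (ℕₚ.m∸n+n≡m k′≤k))

module _ where
  open CommutativeRing ℚ√2-ring
  open IntegerCoefficientSolver ℚ√2-ring
  open ≡.≡-Reasoning

  private
    _∙_ : Poly → Poly → Poly
    _∙_ = RawRing._*_ Poly-rawRing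

    δ : Monomial → Monomial → Carrier
    δ m n = if does (n ≟ᴹ m) then 1# else 0#

  -- Coefficients are linear extensions, and linear extensions of products are double sums,
  -- for which the ring laws are immediate; only congruence of _*_ needs an argument.
  extend : (Monomial → Carrier) → Poly → Carrier
  extend f []            = 0#
  extend f ((c , n) ∷ p) = c * f n + extend f p

  private
    extend-cong : ∀ {f g} → (∀ n → f n ≡ g n) → ∀ p → extend f p ≡ extend g p
    extend-cong f≗g []            = ≡.refl
    extend-cong f≗g ((c , n) ∷ p) = cong₂ _+_ (cong (c *_) (f≗g n)) (extend-cong f≗g p)

    extend-++ : ∀ f p q → extend f (p ++ q) ≡ extend f p + extend f q
    extend-++ f []            q = ≡.sym (+-identityˡ (extend f q))
    extend-++ f ((c , n) ∷ p) q = ≡.trans (cong (λ z → c * f n + z) (extend-++ f p q)) (≡.sym (+-assoc (c * f n) (extend f p) (extend f q)))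

    extend-neg : ∀ f p → extend f (List.map negTerm p) ≡ - extend f p
    extend-neg f []            = solve 0 (con (+ 0) := :- con (+ 0)) ≡.refl
    extend-neg f ((c , n) ∷ p) = ≡.trans (cong (λ z → (- c) * f n + z) (extend-neg f p))
      (solve 3 (λ c d e → (:- c) :* d :+ (:- e) := :- (c :* d :+ e)) ≡.refl c (f n) (extend f p))

    extend-term : ∀ f c m q → extend f (List.map (mulTerm (c , m)) q) ≡ c * extend (λ n → f (m ·ᴹ n)) q
    extend-term f c m []            = ≡.sym (zeroʳ c)
    extend-term f c m ((d , n) ∷ q) = ≡.trans (cong (λ z → c * d * f (m ·ᴹ n) + z) (extend-term f c m q))
      (solve 4 (λ c d e g → c :* d :* e :+ c :* g := c :* (d :* e :+ g)) ≡.refl c d (f (m ·ᴹ n)) (extend (λ n → f (m ·ᴹ n)) q))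

    extend-* : ∀ f p q → extend f (p ∙ q) ≡ extend (λ m → extend (λ n → f (m ·ᴹ n)) q) p
    extend-* f []            q = ≡.refl
    extend-* f ((c , m) ∷ p) q = ≡.trans (extend-++ f (List.map (mulTerm (c , m)) q) (p ∙ q))
      (cong₂ _+_ (extend-term f c m q) (extend-* f p q))

    extend-+ : ∀ f g p → extend (λ n → f n + g n) p ≡ extend f p + extend g p
    extend-+ f g []            = ≡.sym (+-identityˡ 0#)
    extend-+ f g ((c , n) ∷ p) = ≡.trans (cong (λ z → c * (f n + g n) + z) (extend-+ f g p))
      (solve 5 (λ c a b d e → c :* (a :+ b) :+ (d :+ e) := c :* a :+ d :+ (c :* b :+ e)) ≡.refl c (f n) (g n) (extend f p) (extend g p))

    extend-scale : ∀ c f p → extend (λ n → c * f n) p ≡ c * extend f p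
    extend-scale c f []            = ≡.sym (zeroʳ c)
    extend-scale c f ((d , n) ∷ p) = ≡.trans (cong (λ z → d * (c * f n) + z) (extend-scale c f p))
      (solve 4 (λ c d a e → d :* (c :* a) :+ c :* e := c :* (d :* a :+ e)) ≡.refl c d (f n) (extend f p))

    extend-0 : ∀ p → extend (λ _ → 0#) p ≡ 0#
    extend-0 []            = ≡.refl
    extend-0 ((c , n) ∷ p) = ≡.trans (cong₂ _+_ (zeroʳ c) (extend-0 p)) (+-identityˡ 0#)

    extend-swap : ∀ (f : Monomial → Monomial → Carrier) p q →
                  extend (λ m → extend (f m) q) p ≡ extend (λ n → extend (λ m → f m n) p) q
    extend-swap f []            q = ≡.sym (extend-0 q)
    extend-swap f ((c , m) ∷ p) q = begin
      c * extend (f m) q + extend (λ m → extend (f m) q) p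
        ≡⟨ cong₂ _+_ (≡.sym (extend-scale c (f m) q)) (extend-swap f p q) ⟩
      extend (λ n → c * f m n) q + extend (λ n → extend (λ m → f m n) p) q
        ≡⟨ extend-+ (λ n → c * f m n) (λ n → extend (λ m → f m n) p) q ⟨
      extend (λ n → c * f m n + extend (λ m → f m n) p) q
        ∎

    coeff≡extend : ∀ m p → coeff p m ≡ extend (δ m) p
    coeff≡extend m []            = ≡.refl
    coeff≡extend m ((c , n) ∷ p) with n ≟ᴹ m
    ... | yes _ = cong₂ _+_ (≡.sym (*-identityʳ c)) (coeff≡extend m p)
    ... | no  _ = cong₂ _+_ (≡.sym (zeroʳ c)) (coeff≡extend m p)

    coeff-ext : ∀ p q → (∀ f → extend f p ≡ extend f q) → ∀ m → coeff p m ≡ coeff q m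
    coeff-ext p q eq m = ≡.trans (coeff≡extend m p) (≡.trans (eq (δ m)) (≡.sym (coeff≡extend m q)))

    -- Multiplication by a monomial is injective, so δₘ(a · b) is δₙ(a) for some n, or 0 for all a.
    extend-shift-cong : ∀ m b p q → (∀ n → coeff p n ≡ coeff q n) →
                        extend (λ a → δ m (a ·ᴹ b)) p ≡ extend (λ a → δ m (a ·ᴹ b)) q
    extend-shift-cong m b p q p≈q with ·ᴹ-quotient m b
    ... | inj₂ never = ≡.trans (shift≡0 p) (≡.sym (shift≡0 q))
      where
      δ≡0 : ∀ a → δ m (a ·ᴹ b) ≡ 0#
      δ≡0 a with (a ·ᴹ b) ≟ᴹ m
      ... | yes eq = contradiction eq (never a)
      ... | no  _  = ≡.refl
      shift≡0 : ∀ r → extend (λ a → δ m (a ·ᴹ b)) r ≡ 0#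
      shift≡0 r = ≡.trans (extend-cong δ≡0 r) (extend-0 r)
    ... | inj₁ (n , iff) = ≡.trans (shift≡coeff p) (≡.trans (p≈q n) (≡.sym (shift≡coeff q)))
      where
      δ≡δ : ∀ a → δ m (a ·ᴹ b) ≡ δ n a
      δ≡δ a with (a ·ᴹ b) ≟ᴹ m | a ≟ᴹ n
      ... | yes _ | yes _  = ≡.refl
      ... | no  _ | no  _  = ≡.refl
      ... | yes p | no  ¬q = contradiction (Equivalence.to (iff a) p) ¬q
      ... | no ¬p | yes q  = contradiction (Equivalence.from (iff a) q) ¬p
      shift≡coeff : ∀ r → extend (λ a → δ m (a ·ᴹ b)) r ≡ coeff r n
      shift≡coeff r = ≡.trans (extend-cong δ≡δ r) (≡.sym (coeff≡extend n r))

    column : (Monomial → Carrier) → Poly → Monomial → Carrier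
    column f q m = extend (λ n → f (m ·ᴹ n)) q

    -- Exchanging the two sums turns the coefficient of `p ∙ q` into a sum over the terms of `q` in
    -- which `p` enters only through its own coefficients.
    *-congʳ′ : ∀ {p p′} q → (∀ n → coeff p n ≡ coeff p′ n) → ∀ m → coeff (p ∙ q) m ≡ coeff (p′ ∙ q) m
    *-congʳ′ {p} {p′} q p≈p′ m = begin
      coeff (p ∙ q) m                                     ≡⟨ by-columns p ⟩
      extend (λ b → extend (λ a → δ m (a ·ᴹ b)) p) q      ≡⟨ extend-cong (λ b → extend-shift-cong m b p p′ p≈p′) q ⟩
      extend (λ b → extend (λ a → δ m (a ·ᴹ b)) p′) q     ≡⟨ by-columns p′ ⟨
      coeff (p′ ∙ q) m                                    ∎
      where
      by-columns : ∀ r → coeff (r ∙ q) m ≡ extend (λ b → extend (λ a → δ m (a ·ᴹ b)) r) q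
      by-columns r = ≡.trans (coeff≡extend m (r ∙ q))
        (≡.trans (extend-* (δ m) r q) (extend-swap (λ a b → δ m (a ·ᴹ b)) r q))

    *-comm′ : ∀ p q m → coeff (p ∙ q) m ≡ coeff (q ∙ p) m
    *-comm′ p q = coeff-ext (p ∙ q) (q ∙ p) λ f → begin
      extend f (p ∙ q)                            ≡⟨ extend-* f p q ⟩
      extend (λ m → extend (λ n → f (m ·ᴹ n)) q) p ≡⟨ extend-swap (λ m n → f (m ·ᴹ n)) p q ⟩
      extend (λ n → extend (λ m → f (m ·ᴹ n)) p) q ≡⟨ extend-cong (λ n → extend-cong (λ m → cong f (·ᴹ-comm m n)) p) q ⟩
      extend (λ n → extend (λ m → f (n ·ᴹ m)) p) q ≡⟨ extend-* f q p ⟨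
      extend f (q ∙ p)                            ∎

    *-assoc′ : ∀ p q r m → coeff ((p ∙ q) ∙ r) m ≡ coeff (p ∙ (q ∙ r)) m
    *-assoc′ p q r = coeff-ext ((p ∙ q) ∙ r) (p ∙ (q ∙ r)) λ f → begin
      extend f ((p ∙ q) ∙ r)
        ≡⟨ extend-* f (p ∙ q) r ⟩
      extend (λ l → extend (λ n → f (l ·ᴹ n)) r) (p ∙ q)
        ≡⟨ extend-* (column f r) p q ⟩
      extend (λ l → extend (λ m → extend (λ n → f ((l ·ᴹ m) ·ᴹ n)) r) q) p
        ≡⟨ extend-cong (λ l → ≡.trans
             (extend-cong (λ m → extend-cong (λ n → cong f (·ᴹ-assoc l m n)) r) q)
             (≡.sym (extend-* (λ n → f (l ·ᴹ n)) q r))) p ⟩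
      extend (λ l → extend (λ n → f (l ·ᴹ n)) (q ∙ r)) p
        ≡⟨ extend-* f p (q ∙ r) ⟨
      extend f (p ∙ (q ∙ r))
        ∎

  coeff-++ : ∀ p q m → coeff (p ++ q) m ≡ coeff p m + coeff q m
  coeff-++ p q m = ≡.trans (coeff≡extend m (p ++ q))
    (≡.trans (extend-++ (δ m) p q) (cong₂ _+_ (≡.sym (coeff≡extend m p)) (≡.sym (coeff≡extend m q))))

  private
    unit* : ∀ a → 1# * a + 0# ≡ a
    unit* a = ≡.trans (+-identityʳ (1# * a)) (*-identityˡ a)

    coeff-neg : ∀ p m → coeff (List.map negTerm p) m ≡ - coeff p m
    coeff-neg p m = ≡.trans (coeff≡extend m (List.map negTerm p))
      (≡.trans (extend-neg (δ m) p) (cong -_ (≡.sym (coeff≡extend m p))))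

  Poly-laws : CommutativeRingLaws Poly-rawRing
  Poly-laws = record
    { isEquivalence = record
      { refl  = λ _ → ≡.refl
      ; sym   = λ p m → ≡.sym (p m)
      ; trans = λ p q m → ≡.trans (p m) (q m)
      }
    ; +-cong        = λ {p} {p′} {q} {q′} p≈p′ q≈q′ m →
        ≡.trans (coeff-++ p q m) (≡.trans (cong₂ _+_ (p≈p′ m) (q≈q′ m)) (≡.sym (coeff-++ p′ q′ m)))
    ; +-assoc       = λ p q r → coeff-ext ((p ++ q) ++ r) (p ++ (q ++ r)) λ f → begin
        extend f ((p ++ q) ++ r)               ≡⟨ ≡.trans (extend-++ f (p ++ q) r) (cong (_+ extend f r) (extend-++ f p q)) ⟩
        extend f p + extend f q + extend f r   ≡⟨ +-assoc (extend f p) (extend f q) (extend f r) ⟩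
        extend f p + (extend f q + extend f r) ≡⟨ ≡.trans (extend-++ f p (q ++ r)) (cong (λ z → extend f p + z) (extend-++ f q r)) ⟨
        extend f (p ++ (q ++ r))               ∎
    ; +-comm        = λ p q m → ≡.trans (coeff-++ p q m) (≡.trans (+-comm (coeff p m) (coeff q m)) (≡.sym (coeff-++ q p m)))
    ; +-identityˡ   = λ _ _ → ≡.refl
    ; -‿cong        = λ {p} {q} p≈q m →
        ≡.trans (coeff-neg p m) (≡.trans (cong -_ (p≈q m)) (≡.sym (coeff-neg q m)))
    ; -‿inverseˡ    = λ p m → ≡.trans (coeff-++ (List.map negTerm p) p m)
        (≡.trans (cong (_+ coeff p m) (coeff-neg p m)) (-‿inverseˡ (coeff p m)))
    ; *-cong        = λ {p} {p′} {q} {q′} p≈p′ q≈q′ m → ≡.trans (*-congʳ′ {p} {p′} q p≈p′ m)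
        (≡.trans (*-comm′ p′ q m) (≡.trans (*-congʳ′ {q} {q′} p′ q≈q′ m) (*-comm′ q′ p′ m)))
    ; *-assoc       = *-assoc′
    ; *-comm        = *-comm′
    ; *-identityˡ   = λ p → coeff-ext (scalar 1# ∙ p) p λ f → begin
        extend f (scalar 1# ∙ p)
          ≡⟨ extend-* f (scalar 1#) p ⟩
        1# * extend (λ n → f ((0ℤ , 0ℤ , 0) ·ᴹ n)) p + 0#
          ≡⟨ unit* (extend (λ n → f ((0ℤ , 0ℤ , 0) ·ᴹ n)) p) ⟩
        extend (λ n → f ((0ℤ , 0ℤ , 0) ·ᴹ n)) p
          ≡⟨ extend-cong (λ n → cong f (·ᴹ-identityˡ n)) p ⟩
        extend f p
          ∎
    ; distribʳ      = λ r p q → coeff-ext ((p ++ q) ∙ r) ((p ∙ r) ++ (q ∙ r)) λ f → begin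
        extend f ((p ++ q) ∙ r)                  ≡⟨ extend-* f (p ++ q) r ⟩
        extend (column f r) (p ++ q)                    ≡⟨ extend-++ (column f r) p q ⟩
        extend (column f r) p + extend (column f r) q                  ≡⟨ cong₂ _+_ (extend-* f p r) (extend-* f q r) ⟨
        extend f (p ∙ r) + extend f (q ∙ r)      ≡⟨ extend-++ f (p ∙ r) (q ∙ r) ⟨
        extend f ((p ∙ r) ++ (q ∙ r))            ∎
    }

  Poly-ring : CommutativeRing 0ℓ 0ℓ
  Poly-ring = CommutativeRingLaws.commutativeRing Poly-laws

  -- A condition on the listed terms, including those that cancel. It is stronger than vanishing of
  -- coefficients outside `P`, and is preserved by the list operations themselves.
  SupportedIn : ∀ {ℓ} → Pred Monomial ℓ → Pred Poly ℓ
  SupportedIn P = All (P ∘ proj₂)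

  coeff-unsupported : ∀ {ℓ} {P : Pred Monomial ℓ} {p} m → SupportedIn P p → ¬ P m → coeff p m ≡ 0#
  coeff-unsupported                      m []         ¬Pm = ≡.refl
  coeff-unsupported {p = (c , n) ∷ p} m (Pn ∷ Pp) ¬Pm with n ≟ᴹ m
  ... | yes ≡.refl = contradiction Pn ¬Pm
  ... | no  _      = ≡.trans (+-identityˡ (coeff p m)) (coeff-unsupported m Pp ¬Pm)

  *-supported : ∀ {ℓ} {P Q R : Pred Monomial ℓ} → (∀ {m n} → P m → Q n → R (m ·ᴹ n)) →
                ∀ {p q} → SupportedIn P p → SupportedIn Q q → SupportedIn R (p ∙ q)
  *-supported PQR []        Qq = []
  *-supported PQR (Pm ∷ Pp) Qq = Allₚ.++⁺ (Allₚ.map⁺ (All.map (PQR Pm) Qq)) (*-supported PQR Pp Qq)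

  supported-isSubring : ∀ {ℓ} {P : Pred Monomial ℓ} → P (0ℤ , 0ℤ , 0) → (∀ {m n} → P m → P n → P (m ·ᴹ n)) →
                        IsSubring Poly-rawRing (SupportedIn P)
  supported-isSubring P0 P· = record
    { 0∈ = []
    ; 1∈ = P0 ∷ []
    ; +∈ = Allₚ.++⁺
    ; *∈ = *-supported P·
    ; -∈ = Allₚ.map⁺
    }

-- Removing the last step of a walk

module StepSum {c ℓ} (A : CommutativeRing c ℓ) where
  open CommutativeRing A
  open IntegerCoefficientSolver A

  -- The final `0#` matches the empty list that ends the concatenation over the four steps.
  Σₛ : (Step → Carrier) → Carrier
  Σₛ f = f east + (f west + (f north + (f south + 0#)))

  Σₛ-cong : ∀ {f g} → (∀ s → f s ≈ g s) → Σₛ f ≈ Σₛ g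
  Σₛ-cong p = +-cong (p east) (+-cong (p west) (+-cong (p north) (+-congʳ (p south))))

  Σₛ-affineˡ : ∀ {f d g} w → (∀ s → f s ≈ d s * w + g s) → Σₛ f ≈ Σₛ d * w + Σₛ g
  Σₛ-affineˡ {f} {d} {g} w p = trans (Σₛ-cong p)
    (solve 9 (λ w a b c d e f g h →
        a :* w :+ e :+ (b :* w :+ f :+ (c :* w :+ g :+ (d :* w :+ h :+ con (+ 0))))
     := (a :+ (b :+ (c :+ (d :+ con (+ 0))))) :* w :+ (e :+ (f :+ (g :+ (h :+ con (+ 0))))))
      refl w (d east) (d west) (d north) (d south) (g east) (g west) (g north) (g south))

  Σₛ-affineʳ : ∀ {f d g} w → (∀ s → f s ≈ w * d s + g s) → Σₛ f ≈ w * Σₛ d + Σₛ g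
  Σₛ-affineʳ {f} {d} {g} w p =
    trans (Σₛ-affineˡ {f} {d} {g} w λ s → trans (p s) (+-congʳ (*-comm w (d s)))) (+-congʳ (*-comm (Σₛ d) w))

  affine-scale : ∀ {w′ w n} a x → w′ ≈ x * w + n → a * w′ ≈ x * (a * w) + a * n
  affine-scale {w′} {w} {n} a x p = trans (*-congˡ p)
    (solve 4 (λ a x w n → a :* (x :* w :+ n) := x :* (a :* w) :+ a :* n) refl a x w n)

  affine-zero : ∀ x → 0# ≈ x * 0# + 0#
  affine-zero = solve 1 (λ x → con (+ 0) := x :* con (+ 0) :+ con (+ 0)) refl

private module 𝕡 = CommutativeRing Poly-ring
open StepSum Poly-ring

last-satisfies : ∀ {a p} {A : Set a} {P : Pred A p} {n} x {xs : Vec A (suc n)} →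
                 VecAll.All P xs → P (Vec.last (x ∷ xs))
last-satisfies x                   (px VecAll.∷ VecAll.[])        = px
last-satisfies x {xs = y ∷ _ ∷ _} (px VecAll.∷ (pz VecAll.∷ ps)) = last-satisfies y (pz VecAll.∷ ps)

walkWeight : ∀ {n} → Point → Vec Step n → Poly
walkWeight p w with i , j ← Vec.last (p ∷ vertices p w) = monomial (i , j , vert w)

onSlitPlaneFrom? : ∀ {n} p → Decidable (λ (w : Vec Step n) → VecAll.All (λ q → ¬ ℋ q) (vertices p w))
onSlitPlaneFrom? p w = VecAll.all? (λ q → ¬? (ℋ? q)) (vertices p w)

totalWeight : ∀ {n} → Point → List (Vec Step n) → Poly
totalWeight p ws = List.concatMap (walkWeight p) (List.filter (onSlitPlaneFrom? p) ws)

-- At `origin` this unfolds to `S n`. The start varies because step sequences grow at the front, so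
-- an induction has to move it.
W : Point → ℕ → Poly
W p n = totalWeight p (stepSequences n)

Onℋ : Pred Monomial 0ℓ
Onℋ (i , j , _) = ℋ (i , j)

W-off-ℋ : ∀ p n → SupportedIn (λ m → ¬ Onℋ m) (W p (suc n))
W-off-ℋ p n = Allₚ.concat⁺ (Allₚ.map⁺ (All.map off
  (Allₚ.all-filter (onSlitPlaneFrom? p) (stepSequences (suc n)))))
  where
  off : ∀ {w : Vec Step (suc n)} → VecAll.All (λ q → ¬ ℋ q) (vertices p w) →
        SupportedIn (λ m → ¬ Onℋ m) (walkWeight p w)
  off {s ∷ w} ps = last-satisfies p ps ∷ []

level : Step → ℕ
level east  = 0
level west  = 0
level north = 1
level south = 1

-- The last component is the power of v.
displacement : Step → Monomial
displacement east  = 1ℤ  , 0ℤ  , 0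
displacement west  = -1ℤ , 0ℤ  , 0
displacement north = 0ℤ  , 1ℤ  , 1
displacement south = 0ℤ  , -1ℤ , 1

steps : Poly
steps = Σₛ (λ s → monomial (displacement s))

vᵏ : ℕ → Poly
vᵏ k = monomial (0ℤ , 0ℤ , k)

walkWeight-∷ : ∀ {n} p s (w : Vec Step n) → walkWeight p (s ∷ w) 𝕡.≈ vᵏ (level s) 𝕡.* walkWeight (move s p) w
walkWeight-∷ p s w = 𝕡.reflexive (cong (λ m → monomial m)
  (lemma s (Vec.last (move s p ∷ vertices (move s p) w))))
  where
  lemma : ∀ s ((i , j) : Point) → (i , j , vert (s ∷ w)) ≡ (0ℤ , 0ℤ , level s) ·ᴹ (i , j , vert w)
  lemma east  _ = ≡.sym (·ᴹ-identityˡ _)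
  lemma west  _ = ≡.sym (·ᴹ-identityˡ _)
  lemma north _ = ≡.sym (cong (map₂ (map₂ suc)) (·ᴹ-identityˡ _))
  lemma south _ = ≡.sym (cong (map₂ (map₂ suc)) (·ᴹ-identityˡ _))

-- The decision is an argument, so that lemmas can be proved by matching on an arbitrary decision
-- and then applied to `ℋ?`.
unlessHit : ∀ {p} → Dec (ℋ p) → Poly → Poly
unlessHit (yes _) q = []
unlessHit (no  _) q = q

totalWeight-accept : ∀ {n} p (w : Vec Step n) ws → VecAll.All (λ q → ¬ ℋ q) (vertices p w) →
                     totalWeight p (w ∷ ws) ≡ walkWeight p w ++ totalWeight p ws
totalWeight-accept p w ws ok = cong (List.concatMap (walkWeight p)) (Listₚ.filter-accept (onSlitPlaneFrom? p) ok)

totalWeight-reject : ∀ {n} p (w : Vec Step n) ws → ¬ VecAll.All (λ q → ¬ ℋ q) (vertices p w) →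
                     totalWeight p (w ∷ ws) ≡ totalWeight p ws
totalWeight-reject p w ws ko = cong (List.concatMap (walkWeight p)) (Listₚ.filter-reject (onSlitPlaneFrom? p) ko)

totalWeight-++ : ∀ {n} p (ws ws′ : List (Vec Step n)) →
                 totalWeight p (ws ++ ws′) ≡ totalWeight p ws ++ totalWeight p ws′
totalWeight-++ p ws ws′ = ≡.trans
  (cong (List.concatMap (walkWeight p)) (Listₚ.filter-++ (onSlitPlaneFrom? p) ws ws′))
  (Listₚ.concatMap-++ (walkWeight p) (List.filter (onSlitPlaneFrom? p) ws) _)

-- Weights record the absolute endpoint, so a prepended step contributes only its power of `v`; its
-- displacement is absorbed by the new start.
totalWeight-map : ∀ {n} p s (hit? : Dec (ℋ (move s p))) (ws : List (Vec Step n)) →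
                  totalWeight p (List.map (s ∷_) ws)
                    𝕡.≈ unlessHit hit? (vᵏ (level s) 𝕡.* totalWeight (move s p) ws)
totalWeight-map p s (yes _)   []       = 𝕡.refl {[]}
totalWeight-map p s (no  _)   []       = 𝕡.sym {vᵏ (level s) 𝕡.* []} {[]} (𝕡.zeroʳ (vᵏ (level s)))
totalWeight-map p s (yes hit) (w ∷ ws) = 𝕡.trans
  {totalWeight p ((s ∷ w) ∷ List.map (s ∷_) ws)} {totalWeight p (List.map (s ∷_) ws)} {[]}
  (𝕡.reflexive (totalWeight-reject p (s ∷ w) (List.map (s ∷_) ws) λ { (¬hit VecAll.∷ _) → ¬hit hit }))
  (totalWeight-map p s (yes hit) ws)
totalWeight-map p s (no ¬hit) (w ∷ ws) = [ accept , reject ]′ (toSum (onSlitPlaneFrom? (move s p) w))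
  where
  open SetoidReasoning 𝕡.setoid
  a : Poly
  a = vᵏ (level s)
  accept : VecAll.All (λ q → ¬ ℋ q) (vertices (move s p) w) →
           totalWeight p ((s ∷ w) ∷ List.map (s ∷_) ws) 𝕡.≈ a 𝕡.* totalWeight (move s p) (w ∷ ws)
  accept ok = begin
    totalWeight p ((s ∷ w) ∷ List.map (s ∷_) ws)
      ≡⟨ totalWeight-accept p (s ∷ w) (List.map (s ∷_) ws) (¬hit VecAll.∷ ok) ⟩
    walkWeight p (s ∷ w) ++ totalWeight p (List.map (s ∷_) ws)
      ≈⟨ 𝕡.+-cong {walkWeight p (s ∷ w)} {a 𝕡.* walkWeight (move s p) w}
           (walkWeight-∷ p s w) (totalWeight-map p s (no ¬hit) ws) ⟩
    a 𝕡.* walkWeight (move s p) w ++ a 𝕡.* totalWeight (move s p) ws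
      ≈⟨ 𝕡.distribˡ a (walkWeight (move s p) w) (totalWeight (move s p) ws) ⟨
    a 𝕡.* (walkWeight (move s p) w ++ totalWeight (move s p) ws)
      ≡⟨ cong (a 𝕡.*_) (totalWeight-accept (move s p) w ws ok) ⟨
    a 𝕡.* totalWeight (move s p) (w ∷ ws)
      ∎
  reject : ¬ VecAll.All (λ q → ¬ ℋ q) (vertices (move s p) w) →
           totalWeight p ((s ∷ w) ∷ List.map (s ∷_) ws) 𝕡.≈ a 𝕡.* totalWeight (move s p) (w ∷ ws)
  reject ko = begin
    totalWeight p ((s ∷ w) ∷ List.map (s ∷_) ws)
      ≡⟨ totalWeight-reject p (s ∷ w) (List.map (s ∷_) ws) (λ { (_ VecAll.∷ ok) → ko ok }) ⟩
    totalWeight p (List.map (s ∷_) ws)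
      ≈⟨ totalWeight-map p s (no ¬hit) ws ⟩
    a 𝕡.* totalWeight (move s p) ws
      ≡⟨ cong (a 𝕡.*_) (totalWeight-reject (move s p) w ws ko) ⟨
    a 𝕡.* totalWeight (move s p) (w ∷ ws)
      ∎

firstStep : Point → ℕ → Step → Poly
firstStep p n s = unlessHit (ℋ? (move s p)) (vᵏ (level s) 𝕡.* W (move s p) n)

W-firstStep : ∀ p n → W p (suc n) 𝕡.≈ Σₛ (firstStep p n)
W-firstStep p n = 𝕡.trans {W p (suc n)} {Σₛ λ s → totalWeight p (part s)} {Σₛ (firstStep p n)} (𝕡.reflexive split)
  (Σₛ-cong λ s → totalWeight-map p s (ℋ? (move s p)) (stepSequences n))
  where
  part : Step → List (Vec Step (suc n))
  part s = List.map (s ∷_) (stepSequences n)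
  split : W p (suc n) ≡ Σₛ (λ s → totalWeight p (part s))
  split = ≡.trans (totalWeight-++ p (part east) _) (cong (λ z → totalWeight p (part east) ++ z)
    (≡.trans (totalWeight-++ p (part west) _) (cong (λ z → totalWeight p (part west) ++ z)
    (≡.trans (totalWeight-++ p (part north) _) (cong (λ z → totalWeight p (part north) ++ z)
    (totalWeight-++ p (part south) []))))))

onHit : ∀ {p} → Dec (ℋ p) → Poly → Poly
onHit (yes _) q = q
onHit (no  _) q = []

-- Minus the weight of the step sequences of length n + 1 whose last vertex is the first one on ℋ.
firstHits : Point → ℕ → Poly
firstHitsAfter : Point → ℕ → Step → Poly

firstHits p n = Σₛ (firstHitsAfter p n)
firstHitsAfter p zero    s =
  onHit (ℋ? (move s p)) (𝕡.- monomial (proj₁ (move s p) , proj₂ (move s p) , level s))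
firstHitsAfter p (suc n) s = unlessHit (ℋ? (move s p)) (vᵏ (level s) 𝕡.* firstHits (move s p) n)

Σₛ-supported : ∀ {ℓ} {P : Pred Monomial ℓ} {f} → (∀ s → SupportedIn P (f s)) → SupportedIn P (Σₛ f)
Σₛ-supported p = Allₚ.++⁺ (p east) (Allₚ.++⁺ (p west) (Allₚ.++⁺ (p north) (Allₚ.++⁺ (p south) [])))

firstHits-on-ℋ : ∀ p n → SupportedIn Onℋ (firstHits p n)
firstHitsAfter-on-ℋ : ∀ p n s → SupportedIn Onℋ (firstHitsAfter p n s)

firstHits-on-ℋ p n = Σₛ-supported (firstHitsAfter-on-ℋ p n)
firstHitsAfter-on-ℋ p zero s with ℋ? (move s p)
... | yes hit = hit ∷ []
... | no  _   = []
firstHitsAfter-on-ℋ p (suc n) s with ℋ? (move s p)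
... | yes _ = []
-- The prefactor is a power of `v` alone and does not move the endpoint.
... | no  _ = *-supported {P = λ m → m ≡ (0ℤ , 0ℤ , level s)}
  (λ { {n = i , j , _} ≡.refl → ≡.subst ℋ (≡.sym (cong₂ _,_ (ℤₚ.+-identityˡ i) (ℤₚ.+-identityˡ j))) })
  {p = vᵏ (level s)} (≡.refl ∷ []) (firstHits-on-ℋ (move s p) n)

-- A walk followed by an arbitrary step is either a longer walk or meets `ℋ` for the first time at
-- its last vertex; `firstHits` subtracts the latter. The induction passes through the first step,
-- in which all three terms obey the same recursion.
W-lastStep : ∀ n p → W p (suc n) 𝕡.≈ steps 𝕡.* W p n 𝕡.+ firstHits p n
W-lastStep zero p@(i , j) = 𝕡.trans {W p 1} {Σₛ (firstStep p 0)} {steps 𝕡.* W p 0 𝕡.+ firstHits p 0} (W-firstStep p 0)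
  (Σₛ-affineˡ {firstStep p 0} {λ s → monomial (displacement s)} {firstHitsAfter p 0} (W p 0) λ s → cases (ℋ? (move s p))
    (vᵏ (level s) 𝕡.* W (move s p) 0) (monomial (displacement s) 𝕡.* W p 0)
    (monomial (proj₁ (move s p) , proj₂ (move s p) , level s))
    (𝕡.reflexive (cong monomial (left s))) (𝕡.reflexive (cong monomial (right s))))
  where
  left : ∀ s → (0ℤ , 0ℤ , level s) ·ᴹ (proj₁ (move s p) , proj₂ (move s p) , 0)
               ≡ (proj₁ (move s p) , proj₂ (move s p) , level s)
  left s = cong₂ _,_ (ℤₚ.+-identityˡ _) (cong₂ _,_ (ℤₚ.+-identityˡ _) (ℕₚ.+-identityʳ (level s)))
  right : ∀ s → displacement s ·ᴹ (i , j , 0) ≡ (proj₁ (move s p) , proj₂ (move s p) , level s)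
  right east  = cong₂ _,_ (ℤₚ.+-comm 1ℤ i) (cong₂ _,_ (ℤₚ.+-identityˡ j) ≡.refl)
  right west  = cong₂ _,_ (ℤₚ.+-comm -1ℤ i) (cong₂ _,_ (ℤₚ.+-identityˡ j) ≡.refl)
  right north = cong₂ _,_ (ℤₚ.+-identityˡ i) (cong₂ _,_ (ℤₚ.+-comm 1ℤ j) ≡.refl)
  right south = cong₂ _,_ (ℤₚ.+-identityˡ i) (cong₂ _,_ (ℤₚ.+-comm -1ℤ j) ≡.refl)
  cases : ∀ {q} (hit? : Dec (ℋ q)) a b c → a 𝕡.≈ c → b 𝕡.≈ c →
          unlessHit hit? a 𝕡.≈ b 𝕡.+ onHit hit? (𝕡.- c)
  cases (yes _) a b c a≈c b≈c = begin
    []               ≈⟨ 𝕡.-‿inverseʳ c ⟨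
    c 𝕡.+ (𝕡.- c)    ≈⟨ 𝕡.+-congʳ {𝕡.- c} {b} {c} b≈c ⟨
    b 𝕡.+ (𝕡.- c)    ∎
    where open SetoidReasoning 𝕡.setoid
  cases (no _)  a b c a≈c b≈c = begin
    a                ≈⟨ a≈c ⟩
    c                ≈⟨ b≈c ⟨
    b                ≈⟨ 𝕡.+-identityʳ b ⟨
    b 𝕡.+ []         ∎
    where open SetoidReasoning 𝕡.setoid
W-lastStep (suc n) p = begin
  W p (suc (suc n))
    ≈⟨ W-firstStep p (suc n) ⟩
  Σₛ (firstStep p (suc n))
    ≈⟨ Σₛ-affineʳ {firstStep p (suc n)} {firstStep p n} {firstHitsAfter p (suc n)} steps (λ s → cases s (ℋ? (move s p))) ⟩
  steps 𝕡.* Σₛ (firstStep p n) 𝕡.+ firstHits p (suc n)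
    ≈⟨ 𝕡.+-congʳ {firstHits p (suc n)} {steps 𝕡.* W p (suc n)} {steps 𝕡.* Σₛ (firstStep p n)}
         (𝕡.*-congˡ {steps} {W p (suc n)} {Σₛ (firstStep p n)} (W-firstStep p n)) ⟨
  steps 𝕡.* W p (suc n) 𝕡.+ firstHits p (suc n)
    ∎
  where
  open SetoidReasoning 𝕡.setoid
  cases : ∀ s (hit? : Dec (ℋ (move s p))) →
          unlessHit hit? (vᵏ (level s) 𝕡.* W (move s p) (suc n))
            𝕡.≈ steps 𝕡.* unlessHit hit? (vᵏ (level s) 𝕡.* W (move s p) n)
               𝕡.+ unlessHit hit? (vᵏ (level s) 𝕡.* firstHits (move s p) n)
  cases s (yes _) = affine-zero steps
  cases s (no _)  = affine-scale {W (move s p) (suc n)} {W (move s p) n} {firstHits (move s p) n}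
                      (vᵏ (level s)) steps (W-lastStep n (move s p))

-- Power series over the Laurent polynomials

open import Defs

open PowerSeries Poly-ring hiding (Series; _≋_; _⊕_; _⊛_; ⊝_)
private
  module 𝕤 = CommutativeRing seriesRing

  const : Poly → Series
  const = constant Poly-rawRing

½ √two : Series
½    = const (scalar (_+_√2 ℚ.½ ℚ.0ℚ))
√two = const (scalar (_+_√2 ℚ.0ℚ ℚ.1ℚ))

constant-product : ∀ p q r → p 𝕡.* q 𝕡.≈ r → const p * const q ≈ const r
constant-product p q r p*q≈r n = 𝕡.trans {(const p * const q) n} {const (p 𝕡.* q) n} {const r n}
  (constant-⊛-constant p q n) (congruent n)
  where
  congruent : ∀ n → const (p 𝕡.* q) n 𝕡.≈ const r n
  congruent zero    = p*q≈r
  congruent (suc n) = 𝕡.refl {[]}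

constant-2 : const (scalar (RawRing.1# ℚ√2-rawRing) ++ scalar (RawRing.1# ℚ√2-rawRing)) ≈ 2#
constant-2 zero    = 𝕡.refl {2# 0}
constant-2 (suc n) = 𝕡.refl {[]}

2*½≈1 : 2# * ½ ≈ 1#
2*½≈1 = 𝕤.trans {2# * ½} {const (2# 0) * ½} {1#}
  (𝕤.*-congʳ {½} {2#} {const (2# 0)} (𝕤.sym {const (2# 0)} {2#} constant-2))
  (constant-product (2# 0) (½ 0) (1# 0) halves)
  where
  halves : 2# 0 𝕡.* ½ 0 𝕡.≈ 1# 0
  halves m with (0ℤ , 0ℤ , 0) ≟ᴹ m
  ... | yes _ = ≡.refl
  ... | no  _ = ≡.refl

√two-square : √two * √two ≈ 2#
√two-square = 𝕤.trans {√two * √two} {const (2# 0)} {2#}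
  (constant-product (√two 0) (√two 0) (2# 0) surds) constant-2
  where
  surds : √two 0 𝕡.* √two 0 𝕡.≈ 2# 0
  surds m with (0ℤ , 0ℤ , 0) ≟ᴹ m
  ... | yes _ = ≡.refl
  ... | no  _ = ≡.refl

roots : ContractiveRoots seriesRing
roots = record
  { ½             = ½
  ; 2*½≈1         = 2*½≈1
  ; t             = t
  ; root          = Quadratic.root
  ; root-equation = Quadratic.root-equation
  }

scalar∈ : ∀ {P : Pred Monomial 0ℓ} c → P (0ℤ , 0ℤ , 0) → ∀ n → SupportedIn P (const (scalar c) n)
scalar∈ c P0 zero    = P0 ∷ []
scalar∈ c P0 (suc n) = []

monomial∈ : ∀ {P : Pred Monomial 0ℓ} m → P m → ∀ n → SupportedIn P (const (monomial m) n)
monomial∈ m Pm zero    = Pm ∷ []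
monomial∈ m Pm (suc n) = []

module _ {P : Pred Monomial 0ℓ} (P0 : P (0ℤ , 0ℤ , 0)) (P· : ∀ {m n} → P m → P n → P (m ·ᴹ n)) where

  -- Any submonoid of exponents qualifies. The instances used are `ℋ` itself and half-spaces given
  -- by the sign of one exponent.
  supported-isRootClosed : IsRootClosed roots (λ f → ∀ n → SupportedIn P (f n))
  supported-isRootClosed = record
    { isSubring = seriesSubring subring
    ; ½∈        = scalar∈ _ P0
    ; t∈        = indeterminate∈ subring
    ; root∈     = λ {α} {β} {γ} → Quadratic.root∈ α β γ subring
    }
    where
    subring : IsSubring Poly-rawRing (SupportedIn P)
    subring = supported-isSubring P0 P·

x-exponent y-exponent : Monomial → ℤ
x-exponent (i , _ , _) = i
y-exponent (_ , j , _) = j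

-- Meant for `P` a strict and `Q` a weak sign condition on the same exponent: one strictly signed
-- factor makes the whole product strictly signed.
shift-unsupported : ∀ {P Q : Pred Monomial 0ℓ} → (∀ {m n} → P m → Q n → P (m ·ᴹ n)) →
                    ∀ a → P a → ∀ f → (∀ n → SupportedIn Q (f n)) →
                    ∀ n m → ¬ P m → coeff ((const (monomial a) * f) n) m ≡ RawRing.0# ℚ√2-rawRing
shift-unsupported {P} {Q} PQ a Pa f Qf n m = coeff-unsupported m
  (⊛-closed {U = SupportedIn P} {V = SupportedIn Q} {W = SupportedIn P}
    [] Allₚ.++⁺ (*-supported PQ) {const (monomial a)} {f} (monomial∈ a Pa) Qf n)

+-drop-0 : ∀ {a b c} → a ≡ c → b ≡ RawRing.0# ℚ√2-rawRing → a +ᴷ b ≡ c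
+-drop-0 {a} ≡.refl ≡.refl = CommutativeRing.+-identityʳ ℚ√2-ring a

-- The kernel equation and the uniqueness of its solution

X : Series
X = x + x̄ + y * v + ȳ * v

X≈steps : X ≈ const steps
X≈steps n = 𝕡.trans {X n} {((x + x̄) + const (y 0 𝕡.* v 0) + const (ȳ 0 𝕡.* v 0)) n} {const steps n}
  (𝕡.+-cong {((x + x̄) + y * v) n} {((x + x̄) + const (y 0 𝕡.* v 0)) n} {(ȳ * v) n} {const (ȳ 0 𝕡.* v 0) n}
    (𝕡.+-congˡ {(x + x̄) n} {(y * v) n} {const (y 0 𝕡.* v 0) n} (constant-⊛-constant (y 0) (v 0) n))
    (constant-⊛-constant (ȳ 0) (v 0) n))
  (constants n)
  where
  constants : (x + x̄) + const (y 0 𝕡.* v 0) + const (ȳ 0 𝕡.* v 0) ≈ const steps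
  constants zero    = 𝕡.refl {steps}
  constants (suc n) = 𝕡.refl {[]}

-- Only the empty walk ends on `ℋ`.
S-on-ℋ : ∀ n m → Onℋ m → coeff (S n) m ≡ coeff (1# n) m
S-on-ℋ zero    m hit = ≡.refl
S-on-ℋ (suc n) m hit = coeff-unsupported m (W-off-ℋ origin n) λ ¬hit → ¬hit hit

-- S is the only series whose product with the kernel 1 - tX is supported on ℋ and whose
-- coefficients on ℋ are those of 1.
module Uniqueness {G H : Series} (G-step : G ≈ H + t * (X * G))
                  (H-on-ℋ : ∀ n → SupportedIn Onℋ (H n))
                  (G-on-ℋ : ∀ n m → Onℋ m → coeff (G n) m ≡ coeff (1# n) m) where

  G-suc : ∀ n → G (suc n) 𝕡.≈ H (suc n) ++ steps 𝕡.* G n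
  G-suc n = begin
    G (suc n)                             ≈⟨ G-step (suc n) ⟩
    H (suc n) ++ (t * (X * G)) (suc n)
      ≈⟨ 𝕡.+-congˡ {H (suc n)} {(t * (X * G)) (suc n)} {steps 𝕡.* G n} (begin
        (t * (X * G)) (suc n)             ≈⟨ t⊛-suc (X * G) n ⟩
        (X * G) n                         ≈⟨ ⊛-cong {X} {const steps} {G} {G} X≈steps (𝕤.refl {G}) n ⟩
        (const steps * G) n               ≈⟨ constant-⊛ steps G n ⟩
        steps 𝕡.* G n                     ∎) ⟩
    H (suc n) ++ steps 𝕡.* G n            ∎
    where open SetoidReasoning 𝕡.setoid

  G-zero : G 0 𝕡.≈ H 0
  G-zero = 𝕡.trans {G 0} {H 0 ++ (t * (X * G)) 0} {H 0} (G-step 0)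
    (𝕡.trans {H 0 ++ (t * (X * G)) 0} {H 0 ++ []} {H 0}
      (𝕡.+-congˡ {H 0} {(t * (X * G)) 0} {[]} (t⊛-zero (X * G))) (𝕡.+-identityʳ (H 0)))

  -- Coefficients on `ℋ` are prescribed. Off `ℋ` the inhomogeneous terms `firstHits` and `H` both
  -- vanish, so `S` and `G` follow the same recurrence, multiplication by `steps`.
  S≈G : S ≈ G
  S≈G n m with ℋ? (x-exponent m , y-exponent m)
  ... | yes hit = ≡.trans (S-on-ℋ n m hit) (≡.sym (G-on-ℋ n m hit))
  S≈G zero    m | no ¬hit = ≡.trans
    (coeff-unsupported {P = Onℋ} {p = S 0} m ((ℤₚ.≤-refl , ≡.refl) ∷ []) ¬hit)
    (≡.sym (≡.trans (G-zero m) (coeff-unsupported m (H-on-ℋ 0) ¬hit)))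
  S≈G (suc n) m | no ¬hit = begin
    coeff (S (suc n)) m
      ≡⟨ W-lastStep n origin m ⟩
    coeff (steps 𝕡.* S n ++ firstHits origin n) m
      ≡⟨ coeff-++ (steps 𝕡.* S n) (firstHits origin n) m ⟩
    coeff (steps 𝕡.* S n) m +ᴷ coeff (firstHits origin n) m
      ≡⟨ +-drop-0 (𝕡.*-congˡ {steps} {S n} {G n} (S≈G n) m)
             (coeff-unsupported m (firstHits-on-ℋ origin n) ¬hit) ⟩
    coeff (steps 𝕡.* G n) m
      ≡⟨ +-drop-0 ≡.refl (coeff-unsupported m (H-on-ℋ (suc n)) ¬hit) ⟨
    coeff (steps 𝕡.* G n) m +ᴷ coeff (H (suc n)) m
      ≡⟨ coeff-++ (steps 𝕡.* G n) (H (suc n)) m ⟨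
    coeff (steps 𝕡.* G n ++ H (suc n)) m
      ≡⟨ 𝕡.+-comm (steps 𝕡.* G n) (H (suc n)) m ⟩
    coeff (H (suc n) ++ steps 𝕡.* G n) m
      ≡⟨ G-suc n m ⟨
    coeff (G (suc n)) m
      ∎
    where open ≡.≡-Reasoning

0<1 : 0ℤ ℤ.< 1ℤ
0<1 = ℤ.+<+ (s≤s z≤n)

-- On `ℋ` the exponent of `y` is 0, which excludes the terms of `y * R₊` and `ȳ * R₋`, and the
-- exponent of `x` is at most 0, which excludes those of `x * Z`.
constant-on-ℋ : ∀ {G E Z R₊ R₋ : Series} → G ≈ E + y * R₊ + ȳ * R₋ → E ≈ 1# + x * Z →
                (∀ n → SupportedIn (λ m → 0ℤ ℤ.≤ x-exponent m) (Z n)) →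
                (∀ n → SupportedIn (λ m → 0ℤ ℤ.≤ y-exponent m) (R₊ n)) →
                (∀ n → SupportedIn (λ m → y-exponent m ℤ.≤ 0ℤ) (R₋ n)) →
                ∀ n m → Onℋ m → coeff (G n) m ≡ coeff (1# n) m
constant-on-ℋ {G} {E} {Z} {R₊} {R₋} G≈ E≈ Z∈ R₊∈ R₋∈ n m (i≤0 , j≡0) = begin
  coeff (G n) m                                  ≡⟨ G≈ n m ⟩
  coeff ((E n ++ (y * R₊) n) ++ (ȳ * R₋) n) m    ≡⟨ drop (E n ++ (y * R₊) n) ((ȳ * R₋) n) ȳR₋ ⟩
  coeff (E n ++ (y * R₊) n) m                    ≡⟨ drop (E n) ((y * R₊) n) yR₊ ⟩
  coeff (E n) m                                  ≡⟨ E≈ n m ⟩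
  coeff (1# n ++ (x * Z) n) m                    ≡⟨ drop (1# n) ((x * Z) n) xZ ⟩
  coeff (1# n) m                                 ∎
  where
  open ≡.≡-Reasoning
  drop : ∀ p q → coeff q m ≡ RawRing.0# ℚ√2-rawRing → coeff (p ++ q) m ≡ coeff p m
  drop p q q≡0 = ≡.trans (coeff-++ p q m) (+-drop-0 ≡.refl q≡0)
  xZ : coeff ((x * Z) n) m ≡ RawRing.0# ℚ√2-rawRing
  xZ = shift-unsupported {λ m → 0ℤ ℤ.< x-exponent m} ℤₚ.+-mono-<-≤ (1ℤ , 0ℤ , 0) 0<1 Z Z∈ n m
    (ℤₚ.≤⇒≯ i≤0)
  yR₊ : coeff ((y * R₊) n) m ≡ RawRing.0# ℚ√2-rawRing
  yR₊ = shift-unsupported {λ m → 0ℤ ℤ.< y-exponent m} ℤₚ.+-mono-<-≤ (0ℤ , 1ℤ , 0) 0<1 R₊ R₊∈ n m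
    (ℤₚ.≤⇒≯ (ℤₚ.≤-reflexive j≡0))
  ȳR₋ : coeff ((ȳ * R₋) n) m ≡ RawRing.0# ℚ√2-rawRing
  ȳR₋ = shift-unsupported {λ m → y-exponent m ℤ.< 0ℤ} ℤₚ.+-mono-<-≤ (0ℤ , -1ℤ , 0) ℤ.-<+ R₋ R₋∈ n m
    (ℤₚ.≤⇒≯ (ℤₚ.≤-reflexive (≡.sym j≡0)))

-- The explicit solution and its supports

private
  module 𝕎 = Radicals.WienerHopf roots x x̄ y ȳ v √two
    (constant-product (x 0) (x̄ 0) (1# 0) (𝕡.refl {1# 0})) (constant-product (y 0) (ȳ 0) (1# 0) (𝕡.refl {1# 0}))
    √two-square

  nonneg-x nonneg-y nonpos-y : Pred Monomial 0ℓ
  nonneg-x m = 0ℤ ℤ.≤ x-exponent m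
  nonneg-y m = 0ℤ ℤ.≤ y-exponent m
  nonpos-y m = y-exponent m ℤ.≤ 0ℤ

  H∈ : ∀ n → SupportedIn Onℋ (𝕎.H n)
  H∈ = 𝕎.H∈ (supported-isRootClosed {Onℋ} (ℤₚ.≤-refl , ≡.refl)
      λ { (p , ≡.refl) (q , ≡.refl) → ℤₚ.+-mono-≤ p q , ≡.refl })
    (monomial∈ _ (ℤₚ.≤-refl , ≡.refl)) (monomial∈ _ (ℤ.-≤+ , ≡.refl))

  Z∈ : ∀ n → SupportedIn nonneg-x (𝕎.Z n)
  Z∈ = 𝕎.Z∈ (supported-isRootClosed {nonneg-x} ℤₚ.≤-refl ℤₚ.+-mono-≤)
    (monomial∈ _ ℤₚ.≤-refl) (monomial∈ _ (ℤₚ.<⇒≤ 0<1))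

  R₊∈ : ∀ n → SupportedIn nonneg-y ((𝕎.E * 𝕎.Y * 𝕎.P) n)
  R₊∈ = 𝕎.E*Y*geometric∈ (supported-isRootClosed {nonneg-y} ℤₚ.≤-refl ℤₚ.+-mono-≤)
    (monomial∈ _ ℤₚ.≤-refl) (monomial∈ _ ℤₚ.≤-refl) (monomial∈ _ ℤₚ.≤-refl)
    {y} (monomial∈ _ (ℤₚ.<⇒≤ 0<1))

  R₋∈ : ∀ n → SupportedIn nonpos-y ((𝕎.E * 𝕎.Y * 𝕎.Q) n)
  R₋∈ = 𝕎.E*Y*geometric∈ (supported-isRootClosed {nonpos-y} ℤₚ.≤-refl ℤₚ.+-mono-≤)
    (monomial∈ _ ℤₚ.≤-refl) (monomial∈ _ ℤₚ.≤-refl) (monomial∈ _ ℤₚ.≤-refl)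
    {ȳ} (monomial∈ _ ℤ.-≤+)

-- Constant terms of the radicals and the closed form

open Radicals roots using (Unital)

unital-constant : ∀ f → Unital f → f 0 𝕡.≈ 1# 0
unital-constant f (a , f≈) = 𝕡.trans {f 0} {(1# + t * a) 0} {1# 0} (f≈ 0) (1⊕t⊛-zero a)

1-positive : Positive (_+_√2 ℚ.1ℚ ℚ.0ℚ)
1-positive = inj₁ (ℚ.*<* 0<1 , ℚ.*<* 0<1)

√2-positive : Positive (_+_√2 ℚ.0ℚ ℚ.1ℚ)
√2-positive = inj₂ (ℚ.*<* 0<1 , ℚ.*<* (ℤ.+<+ (s≤s z≤n)))

√two*unital-constant : ∀ f g → Unital f → Unital g → (√two * (f * g)) 0 𝕡.≈ √two 0
√two*unital-constant f g uf ug = begin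
  (√two * (f * g)) 0       ≈⟨ ⊛-zero √two (f * g) ⟩
  √two 0 𝕡.* (f * g) 0     ≈⟨ 𝕡.*-congˡ {√two 0} {(f * g) 0} {1# 0} (begin
    (f * g) 0                ≈⟨ ⊛-zero f g ⟩
    f 0 𝕡.* g 0              ≈⟨ 𝕡.*-cong {f 0} {1# 0} {g 0} {1# 0} (unital-constant f uf) (unital-constant g ug) ⟩
    1# 0 𝕡.* 1# 0            ≈⟨ 𝕡.*-identityˡ (1# 0) ⟩
    1# 0                     ∎) ⟩
  √two 0 𝕡.* 1# 0          ≈⟨ 𝕡.*-identityʳ (√two 0) ⟩
  √two 0                   ∎
  where open SetoidReasoning 𝕡.setoid

S≈√A*√B*D⁻¹ : S ≈ 𝕎.√A * 𝕎.√B * 𝕎.D⁻¹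
S≈√A*√B*D⁻¹ = 𝕤.trans {S} {𝕎.G} {𝕎.√A * 𝕎.√B * 𝕎.D⁻¹}
  (Uniqueness.S≈G {𝕎.G} {𝕎.H} 𝕎.G-step H∈
    (constant-on-ℋ {𝕎.G} {𝕎.E} {𝕎.Z} {𝕎.E * 𝕎.Y * 𝕎.P} {𝕎.E * 𝕎.Y * 𝕎.Q}
      𝕎.G-expansion 𝕎.E-expansion Z∈ R₊∈ R₋∈))
  (𝕤.sym {𝕎.√A * 𝕎.√B * 𝕎.D⁻¹} {𝕎.G} 𝕎.√A*√B*D⁻¹≈G)

mainTheorem6 : ∃[ √δ₁ ] ∃[ √δ₂ ] ∃[ √A ] ∃[ √B ] ∃[ D⁻¹ ]
    ( (√δ₁ IsSqrtOf δ₁)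
    × (√δ₂ IsSqrtOf δ₂)
    × (√A IsSqrtOf (1# - 2# * t * (v + x̄) + √δ₁))
    × (√B IsSqrtOf (1# + 2# * t * (v - x̄) + √δ₂))
    × (D⁻¹ IsReciprocalOf (2# * (1# - t * (x + x̄ + y * v + ȳ * v))))
    × (S ≈ √A * √B * D⁻¹)
    )
mainTheorem6 =
  F₁.√δ , F₂.√δ , 𝕎.√A , 𝕎.√B , 𝕎.D⁻¹ ,
  (F₁.√δ-square , _ , 1-positive , unital-constant F₁.√δ F₁.√δ-unital) ,
  (𝕎.√δ₂-square , _ , 1-positive , unital-constant F₂.√δ F₂.√δ-unital) ,
  (𝕎.√A-square , _ , √2-positive ,
    √two*unital-constant F₁.√e (F₁.ρ x̄) F₁.√e-unital (F₁.ρ-unital x̄)) ,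
  (𝕎.√B-square , _ , √2-positive ,
    √two*unital-constant F₂.√e (F₂.ρ x̄) F₂.√e-unital (F₂.ρ-unital x̄)) ,
  𝕎.D⁻¹-inverse ,
  S≈√A*√B*D⁻¹
  where
  module F₁ = 𝕎.F₁
  module F₂ = 𝕎.F₂
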